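{- Let $G$ be a finite, simple, undirected graph with $n$ vertices, $m$ edges, and $k$ connected components, and let $c_1$ denote the number of induced cycles of $G$ whose length is congruent to $1$ modulo $3$. Then $$\mathrm{diss}(G)\geq n-\frac{1}{3}\Big(m+k+c_1\Big).$$
   Context: A set $D$ of vertices of a graph $G$ is a dissociation set if the subgraph $G[D]$ induced by $D$ has maximum degree at most $1$. The dissociation number $\mathrm{diss}(G)$ is the maximum order of a dissociation set in $G$. An induced cycle is an induced subgraph that is a cycle (of length at least $3$). -}

module Defs where

open import Data.Nat using (ℕ; zero; suc; _+_; _%_)
open import Data.Bool using (Bool; true; false; _∧_; _∨_; not; if_then_else_; T)
open import Data.Fin using (Fin; zero; suc; _<_; _≟_)
open import Data.Fin.Properties using ()
open import Data.List using (List; []; _∷_; map; _++_; allFin; filter; length)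
open import Data.Bool.ListAction using (any; all)
open import Relation.Nullary.Decidable using (⌊_⌋)
open import Relation.Binary.PropositionalEquality using (_≡_)
open import Relation.Nullary using (¬_)
open import Data.Fin using (_<?_)

record Graph (n : ℕ) : Set where
  field
    adj   : Fin n → Fin n → Bool
    sym   : ∀ u v → adj u v ≡ adj v u
    irrefl : ∀ v → adj v v ≡ false
open Graph public

VSet : ℕ → Set
VSet n = Fin n → Bool

count : ∀ {n} → (Fin n → Bool) → ℕ
count {n} p = length (filter (λ v → Data.Bool._≟_ (p v) true) (allFin n))

∣_∣ : ∀ {n} → VSet n → ℕ
∣ S ∣ = count S

allVSets : (n : ℕ) → List (VSet n)
allVSets zero = (λ ()) ∷ []
allVSets (suc n) = map (λ S → cons false S) (allVSets n) ++ map (λ S → cons true S) (allVSets n)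
  where
  cons : Bool → VSet n → VSet (suc n)
  cons b S zero = b
  cons b S (suc i) = S i

edges : ∀ {n} → Graph n → ℕ
edges {n} G = length (filter (λ uv → Data.Bool._≟_ (⌊ proj₁' uv <? proj₂' uv ⌋ ∧ adj G (proj₁' uv) (proj₂' uv)) true)
                       (pairs (allFin n)))
  where
  open import Data.Product using (_×_; _,_) renaming (proj₁ to proj₁'; proj₂ to proj₂')
  pairs : List (Fin n) → List (Fin n × Fin n)
  pairs xs = Data.List.concatMap (λ u → map (λ v → (u , v)) xs) xs

reachW : ∀ {n} → (Fin n → Fin n → Bool) → ℕ → Fin n → Fin n → Bool
reachW a zero u v = ⌊ u ≟ v ⌋
reachW {n} a (suc t) u v = reachW a t u v ∨ any (λ w → reachW a t u w ∧ a w v) (allFin n)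

-- u and v lie in the same connected component (walks of length ≤ n suffice)
reach : ∀ {n} → Graph n → Fin n → Fin n → Bool
reach {n} G = reachW (adj G) n

-- number of connected components: count the vertices that are the least
-- vertex of their component
components : ∀ {n} → Graph n → ℕ
components {n} G = count (λ v → not (any (λ u → ⌊ u <? v ⌋ ∧ reach G u v) (allFin n)))

degIn : ∀ {n} → Graph n → VSet n → Fin n → ℕ
degIn G S v = count (λ u → S u ∧ adj G v u)

-- G[S] is a cycle: |S| ≥ 3, G[S] is 2-regular and connected
isInducedCycle : ∀ {n} → Graph n → VSet n → Bool
isInducedCycle {n} G S =
  ⌊ 3 Data.Nat.≤? ∣ S ∣ ⌋
  ∧ all (λ v → not (S v) ∨ ⌊ degIn G S v Data.Nat.≟ 2 ⌋) (allFin n)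
  ∧ all (λ u → all (λ v → not (S u ∧ S v) ∨ reachW (λ x y → S x ∧ S y ∧ adj G x y) n u v) (allFin n)) (allFin n)

-- c₁(G): number of induced cycles whose length is ≡ 1 (mod 3)
-- (an induced cycle is determined by its vertex set)
c₁ : ∀ {n} → Graph n → ℕ
c₁ {n} G = length (filter (λ S → Data.Bool._≟_ (isInducedCycle G S ∧ ⌊ ∣ S ∣ % 3 Data.Nat.≟ 1 ⌋) true) (allVSets n))

IsDissociationSet : ∀ {n} → Graph n → VSet n → Set
IsDissociationSet G D = ∀ v → T (D v) → degIn G D v Data.Nat.≤ 1

{-# OPTIONS --safe #-}
module Submission where

open import Defs
open import Data.Nat using (ℕ; zero; suc; _+_; _*_; _≤_; _<_; z≤n; s≤s; _%_)
open import Data.Nat.Properties as ℕ using (≤-refl; ≤-trans; module ≤-Reasoning)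
open import Data.Nat.DivMod using ([m+n]%n≡m%n; %-distribˡ-+)
open import Data.Nat.Tactic.RingSolver using (solve-∀)
open import Data.Bool using (Bool; true; false; _∧_; _∨_; not; T; if_then_else_)
open import Data.Bool.Properties using (T-∧; T-∨; T-≡; T?)
open import Data.Bool.ListAction using (any; all)
open import Data.Fin as Fin using (Fin; _≟_; _<?_)
open import Data.Fin.Properties as FinP using (any?)
open import Data.List using (List; []; _∷_; _++_; map; take; length; filter; allFin; cartesianProduct)
open import Data.List.Properties using (length-++; length-map; length-tabulate; filter-notAll)
open import Data.List.Membership.Propositional using (_∈_; _∉_)
open import Data.List.Membership.Propositional.Properties
open import Data.List.Relation.Unary.Any as Any using (Any; here; there)
import Data.List.Relation.Unary.Any.Properties as Any
open import Data.List.Relation.Unary.All as All using (All; []; _∷_)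
import Data.List.Relation.Unary.All.Properties as All
open import Data.List.Relation.Unary.AllPairs using ([]; _∷_)
open import Data.List.Relation.Unary.Unique.Propositional using (Unique)
import Data.List.Relation.Unary.Unique.Propositional.Properties as Unique
open import Data.List.Relation.Unary.Linked as Linked using (Linked; []; [-]; _∷_)
open import Data.Product using (Σ; ∃; ∃₂; _×_; _,_; proj₁; proj₂)
open import Data.Sum using (_⊎_; inj₁; inj₂; [_,_]′)
open import Data.Empty using (⊥; ⊥-elim)
open import Data.Unit using (tt)
open import Function using (_∘_; id; Equivalence)
open import Relation.Nullary using (¬_; Dec; yes; no; contradiction)
open import Relation.Nullary.Decidable using (⌊_⌋; toWitness; fromWitness; decidable-stable; _×-dec_; ¬?)
open import Relation.Binary.PropositionalEquality as ≡ using (_≡_; _≢_; refl; cong; subst)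

-- Induct on the vertex set S, running a depth-first search in G[S], so that all neighbours of a vertex v that is being
-- finished are ancestors or lie in finished subtrees below v. As long as no reduction applies, a finished subtree is a
-- pendant path with at most two vertices, or an arc: a path whose last vertex has one further edge to an ancestor.
-- Deleting v, keeping as much as possible of the pendant paths and of the arcs closing a cycle through v (two of every
-- three consecutive vertices), and leaving the remaining arcs attached to their ancestors does not create components.
-- An upward edge of v, a pendant vertex and an arc are each worth 1, a pendant pair is worth 2, and an arc closing
-- a cycle of length l through v is worth 1 + ((l - 1) mod 3), plus 1 if l is 1 modulo 3, because an induced cycle is
-- destroyed. If these values add up to 3, the deletion of v is paid for and induction applies. Otherwise v together
-- with what is below it is again a pendant path or an arc. Being the root is worth as much as an upward edge, because
-- a component disappears.

private
  variable
    n : ℕ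

-- Counting with duplicate-free lists

-- Every comparison of cardinalities of vertex sets and edge sets below rests on this: an occurrence
-- of the head is cut out of the longer list, and the tail still fits into the rest because it does
-- not repeat the head.
unique-⊆-length : ∀ {A : Set} {xs ys : List A} → Unique xs →
  (∀ {x} → x ∈ xs → x ∈ ys) → length xs ≤ length ys
unique-⊆-length [] _ = z≤n
unique-⊆-length {xs = x ∷ xs} (x∉ ∷ u) sub with ∈-∃++ (sub (here refl))
... | as , bs , refl = begin
  suc (length xs)             ≤⟨ s≤s (unique-⊆-length u sub′) ⟩
  suc (length (as ++ bs))     ≡⟨ cong suc (length-++ as) ⟩
  suc (length as + length bs) ≡⟨ ℕ.+-suc (length as) (length bs) ⟨
  length as + suc (length bs) ≡⟨ length-++ as ⟨
  length (as ++ x ∷ bs)       ∎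
  where
  open ≤-Reasoning
  sub′ : ∀ {y} → y ∈ xs → y ∈ as ++ bs
  sub′ y∈ with ∈-++⁻ as (sub (there y∈))
  ... | inj₁ y∈as = ∈-++⁺ˡ y∈as
  ... | inj₂ (here refl) = contradiction refl (All.lookup x∉ y∈)
  ... | inj₂ (there y∈bs) = ∈-++⁺ʳ as y∈bs

module _ {A : Set} {p q : A → Bool} (p⇒q : ∀ {x} → T (p x) → T (q x)) where

  -- Meant for `c₁`, which filters a list of functions. Filtering one and the same list by two
  -- predicates avoids having to compare functions for equality.
  length-filter-mono : ∀ xs → length (filter (λ x → Data.Bool._≟_ (p x) true) xs) ≤
                              length (filter (λ x → Data.Bool._≟_ (q x) true) xs)
  length-filter-mono [] = z≤n
  length-filter-mono (x ∷ xs) with p x | q x | p⇒q {x}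
  ... | true | true | _ = s≤s (length-filter-mono xs)
  ... | true | false | f = ⊥-elim (f tt)
  ... | false | true | _ = ℕ.m≤n⇒m≤1+n (length-filter-mono xs)
  ... | false | false | _ = length-filter-mono xs

  length-filter-strict : ∀ {x xs} → x ∈ xs → T (q x) → ¬ T (p x) →
    length (filter (λ x → Data.Bool._≟_ (p x) true) xs) < length (filter (λ x → Data.Bool._≟_ (q x) true) xs)
  length-filter-strict {x} {_ ∷ xs} (here refl) qx ¬px with p x | q x
  ... | true | _ = ⊥-elim (¬px tt)
  ... | false | true = s≤s (length-filter-mono xs)
  length-filter-strict {xs = y ∷ xs} (there x∈) qx ¬px with p y | q y | p⇒q {y}
  ... | true | true | _ = s≤s (length-filter-strict x∈ qx ¬px)
  ... | true | false | f = ⊥-elim (f tt)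
  ... | false | true | _ = ℕ.m≤n⇒m≤1+n (length-filter-strict x∈ qx ¬px)
  ... | false | false | _ = length-filter-strict x∈ qx ¬px

take₁⊆ : ∀ {A : Set} {y : A} xs → y ∈ take 1 xs → y ∈ xs
take₁⊆ (x ∷ _) (here refl) = here refl

-- Dropping every third vertex cuts a path into pieces of at most two vertices, hence leaves a
-- dissociation set. A remainder of one or two vertices at the end is kept whole.
keep : ∀ {A : Set} → List A → List A
keep [] = []
keep (x ∷ []) = x ∷ []
keep (x ∷ y ∷ []) = x ∷ y ∷ []
keep (x ∷ y ∷ _ ∷ xs) = x ∷ y ∷ keep xs

keep-⊆ : ∀ {A : Set} (xs : List A) {y} → y ∈ keep xs → y ∈ xs
keep-⊆ (x ∷ []) y∈ = y∈
keep-⊆ (x ∷ y ∷ []) y∈ = y∈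
keep-⊆ (x ∷ y ∷ z ∷ xs) (here refl) = here refl
keep-⊆ (x ∷ y ∷ z ∷ xs) (there (here refl)) = there (here refl)
keep-⊆ (x ∷ y ∷ z ∷ xs) (there (there w∈)) = there (there (there (keep-⊆ xs w∈)))

keep-unique : ∀ {A : Set} {xs : List A} → Unique xs → Unique (keep xs)
keep-unique {xs = []} u = u
keep-unique {xs = _ ∷ []} u = u
keep-unique {xs = _ ∷ _ ∷ []} u = u
keep-unique {xs = _ ∷ _ ∷ _ ∷ xs} ((x≢y ∷ _ ∷ x∉) ∷ (_ ∷ y∉) ∷ _ ∷ u) =
  (x≢y ∷ All.tabulate (All.lookup x∉ ∘ keep-⊆ xs)) ∷ All.tabulate (All.lookup y∉ ∘ keep-⊆ xs) ∷ keep-unique u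

-- A full block of three keeps two vertices, and a remainder `r` keeps `r`, where 3r = 2r + r. The
-- factor 3 avoids division.
keep-length : ∀ {A : Set} (xs : List A) → 3 * length (keep xs) ≡ 2 * length xs + length xs % 3
keep-length [] = refl
keep-length (_ ∷ []) = refl
keep-length (_ ∷ _ ∷ []) = refl
keep-length (x ∷ y ∷ z ∷ xs) = begin
  3 * (2 + k)                 ≡⟨ ℕ.*-distribˡ-+ 3 2 k ⟩
  6 + 3 * k                   ≡⟨ cong (6 +_) (keep-length xs) ⟩
  6 + (2 * l + l % 3)         ≡⟨ ℕ.+-assoc 6 (2 * l) (l % 3) ⟨
  6 + 2 * l + l % 3           ≡⟨ cong (_+ l % 3) (ℕ.*-distribˡ-+ 2 3 l) ⟨
  2 * (3 + l) + l % 3         ≡⟨ cong (2 * (3 + l) +_) (≡.trans (cong (_% 3) (ℕ.+-comm 3 l)) ([m+n]%n≡m%n l 3)) ⟨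
  2 * (3 + l) + (3 + l) % 3   ∎
  where
  open ≡.≡-Reasoning
  k = length (keep xs)
  l = length xs

-- Boolean predicates and vertex sets

≡true⇒T : ∀ {b} → b ≡ true → T b
≡true⇒T = Equivalence.from T-≡

T⇒≡true : ∀ {b} → T b → b ≡ true
T⇒≡true = Equivalence.to T-≡

∧-intro : ∀ {a b} → T a → T b → T (a ∧ b)
∧-intro p q = Equivalence.from T-∧ (p , q)

∧-elim : ∀ {a b} → T (a ∧ b) → T a × T b
∧-elim = Equivalence.to T-∧

not⁺ : ∀ {b} → ¬ T b → T (not b)
not⁺ {true} ¬b = ¬b tt
not⁺ {false} _ = tt

imp⁺ : ∀ {a b} → (T a → T b) → T (not a ∨ b)
imp⁺ {true} f = f tt
imp⁺ {false} f = tt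

imp⁻ : ∀ {a b} → T (not a ∨ b) → T a → T b
imp⁻ {true} f _ = f

infix 4 _∈ˢ_ _⊆ˢ_

_∈ˢ_ : Fin n → VSet n → Set
x ∈ˢ S = T (S x)

_⊆ˢ_ : VSet n → VSet n → Set
S ⊆ˢ S′ = ∀ {x} → x ∈ˢ S → x ∈ˢ S′

all-Fin⁺ : (p : Fin n → Bool) → (∀ x → T (p x)) → T (all p (allFin n))
all-Fin⁺ {n} p f = All.all⁻ p (All.universal f (allFin n))

subset : VSet n → VSet n → Bool
subset {n} C S = all (λ x → not (C x) ∨ S x) (allFin n)

subset⁺ : {C S : VSet n} → C ⊆ˢ S → T (subset C S)
subset⁺ {C = C} sub = all-Fin⁺ _ λ x → imp⁺ {C x} sub

subset⁻ : {C S : VSet n} → T (subset C S) → C ⊆ˢ S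
subset⁻ {n} {C} {S} t {x} = imp⁻ {C x} (All.lookup (All.all⁺ (λ x → not (C x) ∨ S x) (allFin n) t) (∈-allFin x))

elements : VSet n → List (Fin n)
elements {n} S = filter (λ v → Data.Bool._≟_ (S v) true) (allFin n)

elements⁺ : (S : VSet n) → ∀ {x} → x ∈ˢ S → x ∈ elements S
elements⁺ S {x} x∈ = ∈-filter⁺ (λ v → Data.Bool._≟_ (S v) true) (∈-allFin x) (T⇒≡true x∈)

elements⁻ : (S : VSet n) → ∀ {x} → x ∈ elements S → x ∈ˢ S
elements⁻ S x∈ = ≡true⇒T (proj₂ (∈-filter⁻ (λ v → Data.Bool._≟_ (S v) true) {xs = allFin _} x∈))

elements-unique : (S : VSet n) → Unique (elements S)
elements-unique {n} S = Unique.filter⁺ (λ v → Data.Bool._≟_ (S v) true) (Unique.allFin⁺ n)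

length≤∣∣ : (S : VSet n) → ∀ {xs} → Unique xs → (∀ {x} → x ∈ xs → x ∈ˢ S) → length xs ≤ ∣ S ∣
length≤∣∣ S u sub = unique-⊆-length u (elements⁺ S ∘ sub)

∣∣≤length : (S : VSet n) → ∀ {xs} → (∀ {x} → x ∈ˢ S → x ∈ xs) → ∣ S ∣ ≤ length xs
∣∣≤length S sub = unique-⊆-length (elements-unique S) (sub ∘ elements⁻ S)

∣∣-strict : {S S′ : VSet n} {x : Fin n} → S ⊆ˢ S′ → x ∈ˢ S′ → ¬ x ∈ˢ S → ∣ S ∣ < ∣ S′ ∣
∣∣-strict {S = S} {S′} {x} sub x∈ x∉ = length≤∣∣ S′
  (All.tabulate (λ { y∈ refl → x∉ (elements⁻ S y∈) }) ∷ elements-unique S)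
  λ { (here refl) → x∈ ; (there y∈) → sub (elements⁻ S y∈) }

∣∣≤n : (S : VSet n) → ∣ S ∣ ≤ n
∣∣≤n {n} S = ≤-trans (∣∣≤length S {allFin n} (λ {x} _ → ∈-allFin x))
  (ℕ.≤-reflexive (length-tabulate id))

_∈?_ : (x : Fin n) (xs : List (Fin n)) → Dec (x ∈ xs)
_∈?_ = DecMem._∈?_ _≟_
  where import Data.List.Membership.DecPropositional as DecMem

del : VSet n → Fin n → VSet n
del S x u = S u ∧ not ⌊ u ≟ x ⌋

del⁺ : (S : VSet n) → ∀ {x u} → u ∈ˢ S → u ≢ x → u ∈ˢ del S x
del⁺ S {x} {u} u∈ u≢ with u ≟ x
... | yes u≡ = contradiction u≡ u≢
... | no _ = ∧-intro u∈ tt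

del⁻ : (S : VSet n) → ∀ {x u} → u ∈ˢ del S x → u ∈ˢ S × u ≢ x
del⁻ S {x} {u} u∈ with u ≟ x | ∧-elim {S u} u∈
... | no u≢ | u∈S , _ = u∈S , u≢

del-split : (S : VSet n) → ∀ {x u} → u ∈ˢ S → u ≡ x ⊎ u ∈ˢ del S x
del-split S {x} {u} u∈ with u ≟ x
... | yes u≡ = inj₁ u≡
... | no u≢ = inj₂ (∧-intro u∈ tt)

∣del∣ : (S : VSet n) → ∀ x → ∣ S ∣ ≤ suc ∣ del S x ∣
∣del∣ S x = ∣∣≤length S {x ∷ elements (del S x)} λ u∈ → [ here , there ∘ elements⁺ (del S x) ]′ (del-split S u∈)

infixl 5 _∖_

-- Vertices leave one at a time, in list order, so that the edges lost can be counted deletion by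
-- deletion.
_∖_ : VSet n → List (Fin n) → VSet n
S ∖ [] = S
S ∖ (x ∷ xs) = del S x ∖ xs

∖⁺ : (S : VSet n) → ∀ xs {u} → u ∈ˢ S → u ∉ xs → u ∈ˢ S ∖ xs
∖⁺ S [] u∈ _ = u∈
∖⁺ S (x ∷ xs) u∈ u∉ = ∖⁺ (del S x) xs (del⁺ S u∈ (u∉ ∘ here)) (u∉ ∘ there)

∖⁻ : (S : VSet n) → ∀ xs {u} → u ∈ˢ S ∖ xs → u ∈ˢ S × u ∉ xs
∖⁻ S [] u∈ = u∈ , λ ()
∖⁻ S (x ∷ xs) u∈ with ∖⁻ (del S x) xs u∈
... | u∈del , u∉xs with del⁻ S u∈del
... | u∈S , u≢x = u∈S , λ { (here u≡x) → u≢x u≡x ; (there u∈xs) → u∉xs u∈xs }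

∣∖∣ : (R : VSet n) → ∀ xs → ∣ R ∣ ≤ length xs + ∣ R ∖ xs ∣
∣∖∣ R [] = ≤-refl
∣∖∣ R (x ∷ xs) = ≤-trans (∣del∣ R x) (s≤s (∣∖∣ (del R x) xs))

redirect : VSet n → Fin n → Fin n → Fin n
redirect S′ h u = if S′ u then u else h

redirect-in : (S′ : VSet n) → ∀ h {u} → u ∈ˢ S′ → redirect S′ h u ≡ u
redirect-in S′ h u∈ rewrite T⇒≡true u∈ = refl

redirect-out : (S′ : VSet n) → ∀ h {u} → ¬ u ∈ˢ S′ → redirect S′ h u ≡ h
redirect-out S′ h {u} u∉ with S′ u
... | true = contradiction tt u∉
... | false = refl

-- Edges are counted as pairs with the smaller end first; for distinct `x` and `y` this is the pair
-- that stands for the edge between them.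
orient : Fin n → Fin n → Fin n × Fin n
orient x y with x <? y
... | yes _ = x , y
... | no _ = y , x

orient-injective : (x : Fin n) → ∀ {y z} → orient x y ≡ orient x z → y ≡ z
orient-injective x {y} {z} eq with x <? y | x <? z
orient-injective x refl | yes _ | yes _ = refl
orient-injective x refl | yes _ | no _ = refl
orient-injective x refl | no _ | yes _ = refl
orient-injective x refl | no _ | no _ = refl

-- Pointwise agreement replaces membership of `S` itself, since equality of functions is not
-- extensional.
allVSets-complete : (S : VSet n) → ∃ λ C → C ∈ allVSets n × (∀ x → C x ≡ S x)
allVSets-complete {zero} S = _ , here refl , λ ()
allVSets-complete {suc n} S with allVSets-complete (λ x → S (Fin.suc x))
... | C , C∈ , eq with S Fin.zero in eq₀
... | false = _ , ∈-++⁺ˡ (∈-map⁺ _ C∈) , λ { Fin.zero → ≡.sym eq₀ ; (Fin.suc x) → eq x }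
... | true = _ , ∈-++⁺ʳ _ (∈-map⁺ _ C∈) , λ { Fin.zero → ≡.sym eq₀ ; (Fin.suc x) → eq x }

-- Walks of bounded length

module _ {n : ℕ} (a : Fin n → Fin n → Bool) where

  reachW-refl : ∀ t u → T (reachW a t u u)
  reachW-refl zero u = fromWitness {a? = u ≟ u} refl
  reachW-refl (suc t) u = Equivalence.from T-∨ (inj₁ (reachW-refl t u))

  reachW-mono : ∀ {t t′} u v → t ≤ t′ → T (reachW a t u v) → T (reachW a t′ u v)
  reachW-mono {t′ = zero} u v z≤n r = r
  reachW-mono {t} {suc t′} u v t≤ r with ℕ.m≤n⇒m<n∨m≡n t≤
  ... | inj₁ (s≤s t≤′) = Equivalence.from T-∨ (inj₁ (reachW-mono u v t≤′ r))
  ... | inj₂ refl = r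

  reachW-snoc : ∀ t u {w v} → T (reachW a t u w) → T (a w v) → T (reachW a (suc t) u v)
  reachW-snoc t u {w} {v} r e = Equivalence.from T-∨ (inj₂
    (Any.any⁺ (λ w → reachW a t u w ∧ a w v) (Any.map (λ { refl → ∧-intro r e }) (∈-allFin w))))

  reachW-cons : ∀ t {u w v} → T (a u w) → T (reachW a t w v) → T (reachW a (suc t) u v)
  reachW-cons zero {u} {w} {v} e r with refl ← toWitness {a? = w ≟ v} r = reachW-snoc 0 u (reachW-refl 0 u) e
  reachW-cons (suc t) {u} {w} {v} e r with Equivalence.to (T-∨ {reachW a t w v}) r
  ... | inj₁ r′ = Equivalence.from T-∨ (inj₁ (reachW-cons t e r′))
  ... | inj₂ r′ with Any.satisfied (Any.any⁻ (λ x → reachW a t w x ∧ a x v) (allFin n) r′)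
  ... | x , p with ∧-elim {reachW a t w x} p
  ... | q , e′ = reachW-snoc (suc t) u (reachW-cons t e q) e′

  -- Walking along the path takes at most one step fewer than it has vertices. Both directions of
  -- each link are assumed because `a` is an arbitrary relation.
  reachW-linked : ∀ {z zs} → Linked (λ x y → T (a x y) × T (a y x)) (z ∷ zs) →
    ∀ {u w} → u ∈ z ∷ zs → w ∈ z ∷ zs → T (reachW a (length zs) u w)
  reachW-linked {zs = zs} _ {u} (here refl) (here refl) = reachW-refl (length zs) u
  reachW-linked {zs = _ ∷ zs} (e ∷ l) (here refl) (there w∈) =
    reachW-cons (length zs) (proj₁ e) (reachW-linked l (here refl) w∈)
  reachW-linked {zs = _ ∷ zs} (e ∷ l) {u} (there u∈) (here refl) =
    reachW-snoc (length zs) u (reachW-linked l u∈ (here refl)) (proj₂ e)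
  reachW-linked {zs = _ ∷ zs} (e ∷ l) {u} {w} (there u∈) (there w∈) =
    reachW-mono u w (ℕ.n≤1+n (length zs)) (reachW-linked l u∈ w∈)

-- Edges

module InGraph {n : ℕ} (G : Graph n) where

  infix 4 _~_

  _~_ : Fin n → Fin n → Set
  u ~ v = T (adj G u v)

  ~-sym : ∀ {u v} → u ~ v → v ~ u
  ~-sym {u} {v} = subst T (Defs.sym G u v)

  ~-irrefl : ∀ {u v} → u ~ v → u ≢ v
  ~-irrefl {u} u~u refl = subst T (irrefl G u) u~u

  edgeIn : VSet n → Fin n × Fin n → Bool
  edgeIn S (u , v) = (S u ∧ S v) ∧ ⌊ u <? v ⌋ ∧ adj G u v

  edgesIn : VSet n → List (Fin n × Fin n)
  edgesIn S = filter (λ e → Data.Bool._≟_ (edgeIn S e) true) (cartesianProduct (allFin n) (allFin n))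

  E : VSet n → ℕ
  E S = length (edgesIn S)

  edgesIn-unique : ∀ S → Unique (edgesIn S)
  edgesIn-unique S = Unique.filter⁺ (λ e → Data.Bool._≟_ (edgeIn S e) true)
    (Unique.cartesianProduct⁺ (Unique.allFin⁺ n) (Unique.allFin⁺ n))

  edgesIn⁺ : ∀ S {u v} → u ∈ˢ S → v ∈ˢ S → u Fin.< v → u ~ v → (u , v) ∈ edgesIn S
  edgesIn⁺ S {u} {v} u∈ v∈ u<v u~v =
    ∈-filter⁺ (λ e → Data.Bool._≟_ (edgeIn S e) true)
      (∈-cartesianProduct⁺ (∈-allFin u) (∈-allFin v))
      (T⇒≡true (∧-intro {S u ∧ S v} (∧-intro u∈ v∈) (∧-intro (fromWitness {a? = u <? v} u<v) u~v)))

  edgesIn⁻ : ∀ S {u v} → (u , v) ∈ edgesIn S → u ∈ˢ S × v ∈ˢ S × u Fin.< v × u ~ v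
  edgesIn⁻ S {u} {v} e∈ with ∧-elim {S u ∧ S v} (≡true⇒T (proj₂ (∈-filter⁻ (λ e → Data.Bool._≟_ (edgeIn S e) true)
        {xs = cartesianProduct (allFin n) (allFin n)} e∈)))
  ... | uv , r with ∧-elim {S u} uv | ∧-elim {⌊ u <? v ⌋} r
  ... | u∈ , v∈ | u<v , u~v = u∈ , v∈ , toWitness u<v , u~v

  -- The edges from `x` to `ns`, written as oriented pairs, have `x` as an end and so are disjoint
  -- from the edges that survive.
  E-del : ∀ S {x ns} → x ∈ˢ S → Unique ns → (∀ {y} → y ∈ ns → y ∈ˢ S × x ~ y) →
    E (del S x) + length ns ≤ E S
  E-del S {x} {ns} x∈ u nbr = begin
    E (del S x) + length ns                  ≡⟨ cong (E (del S x) +_) (length-map (orient x) ns) ⟨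
    E (del S x) + length (map (orient x) ns) ≡⟨ length-++ (edgesIn (del S x)) ⟨
    length (edgesIn (del S x) ++ map (orient x) ns)
      ≤⟨ unique-⊆-length (Unique.++⁺ (edgesIn-unique (del S x)) (Unique.map⁺ (orient-injective x) u) disj) sub ⟩
    E S ∎
    where
    open ≤-Reasoning
    disj : ∀ {e} → ¬ (e ∈ edgesIn (del S x) × e ∈ map (orient x) ns)
    disj (e∈ , e∈′) with ∈-map⁻ (orient x) e∈′
    ... | y , y∈ , eq with x <? y
    disj (e∈ , e∈′) | y , y∈ , refl | yes _ = proj₂ (del⁻ S (proj₁ (edgesIn⁻ (del S x) e∈))) refl
    disj (e∈ , e∈′) | y , y∈ , refl | no _ = proj₂ (del⁻ S (proj₁ (proj₂ (edgesIn⁻ (del S x) e∈)))) refl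
    sub : ∀ {e} → e ∈ edgesIn (del S x) ++ map (orient x) ns → e ∈ edgesIn S
    sub e∈ with ∈-++⁻ (edgesIn (del S x)) e∈
    sub {u , v} e∈ | inj₁ e∈₁ = let u∈ , v∈ , u<v , u~v = edgesIn⁻ (del S x) e∈₁ in
      edgesIn⁺ S (proj₁ (del⁻ S u∈)) (proj₁ (del⁻ S v∈)) u<v u~v
    sub e∈ | inj₂ e∈₂ with ∈-map⁻ (orient x) e∈₂
    ... | y , y∈ , eq with x <? y
    sub e∈ | inj₂ e∈₂ | y , y∈ , refl | yes x<y = edgesIn⁺ S x∈ (proj₁ (nbr y∈)) x<y (proj₂ (nbr y∈))
    sub e∈ | inj₂ e∈₂ | y , y∈ , refl | no x≮y = edgesIn⁺ S (proj₁ (nbr y∈)) x∈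
      (FinP.≤∧≢⇒< (ℕ.≮⇒≥ x≮y) (~-irrefl (proj₂ (nbr y∈)) ∘ ≡.sym)) (~-sym (proj₂ (nbr y∈)))

  E≤edges : ∀ S → E S ≤ edges G
  E≤edges S = unique-⊆-length (edgesIn-unique S) λ { {u , v} e∈ →
    let _ , _ , u<v , u~v = edgesIn⁻ S e∈ in
    ∈-filter⁺ _ (∈-concatMap⁺ (λ u → map (λ v → (u , v)) (allFin n))
        (Any.map (λ { refl → ∈-map⁺ (u ,_) (∈-allFin v) }) (∈-allFin u)))
      (T⇒≡true (∧-intro (fromWitness {a? = u <? v} u<v) u~v)) }

  -- Connectivity

  infixr 5 _∷⟨_⟩_

  data Conn (P : Fin n → Set) : Fin n → Fin n → Set where
    ∎_     : ∀ {x} → P x → Conn P x x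
    _∷⟨_⟩_ : ∀ {x y z} → P x → x ~ y → Conn P y z → Conn P x z

  Conn-mono : ∀ {P Q : Fin n → Set} → (∀ {x} → P x → Q x) → ∀ {x y} → Conn P x y → Conn Q x y
  Conn-mono f (∎ p) = ∎ f p
  Conn-mono f (p ∷⟨ e ⟩ c) = f p ∷⟨ e ⟩ Conn-mono f c

  Conn-trans : ∀ {P x y z} → Conn P x y → Conn P y z → Conn P x z
  Conn-trans (∎ _) d = d
  Conn-trans (p ∷⟨ e ⟩ c) d = p ∷⟨ e ⟩ Conn-trans c d

  Conn-source : ∀ {P x y} → Conn P x y → P x
  Conn-source (∎ p) = p
  Conn-source (p ∷⟨ _ ⟩ _) = p

  Conn-target : ∀ {P x y} → Conn P x y → P y
  Conn-target (∎ p) = p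
  Conn-target (_ ∷⟨ _ ⟩ c) = Conn-target c

  Conn-sym : ∀ {P x y} → Conn P x y → Conn P y x
  Conn-sym (∎ p) = ∎ p
  Conn-sym (p ∷⟨ e ⟩ c) = Conn-trans (Conn-sym c) (Conn-source c ∷⟨ ~-sym e ⟩ ∎ p)

  linked-conn : ∀ {P p xs} → Linked _~_ (p ∷ xs) → (∀ {x} → x ∈ p ∷ xs → P x) →
    ∀ {x} → x ∈ p ∷ xs → Conn P x p
  linked-conn _ f (here refl) = ∎ f (here refl)
  linked-conn (e ∷ l) f (there x∈) =
    Conn-trans (linked-conn l (f ∘ there) x∈) (f (there (here refl)) ∷⟨ ~-sym e ⟩ ∎ f (here refl))

  -- A list that meets every component of `G[S]`. Its length stands in for the number of components,
  -- of which it is an upper bound; this is easy to carry through deletions.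
  Cover : VSet n → List (Fin n) → Set
  Cover S L = ∀ {x} → x ∈ˢ S → ∃ λ ℓ → ℓ ∈ L × Conn (_∈ˢ S) x ℓ

  -- A hub to which all neighbours of the deleted part stay connected can replace every deleted representative.
  cover-redirect : ∀ {S S′ h L} → S′ ⊆ˢ S → h ∈ˢ S′ →
    (∀ {x y} → x ∈ˢ S → ¬ x ∈ˢ S′ → y ∈ˢ S′ → x ~ y → Conn (_∈ˢ S′) y h) →
    Cover S L → Cover S′ (map (redirect S′ h) L)
  cover-redirect {S} {S′} {h} {L} sub h∈ hub cov {x} x∈ with cov (sub x∈)
  ... | ℓ , ℓ∈ , c = φ ℓ , ∈-map⁺ φ ℓ∈ , subst (λ z → Conn (_∈ˢ S′) z (φ ℓ)) (redirect-in S′ h x∈) (walk c)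
    where
    φ : Fin n → Fin n
    φ = redirect S′ h
    φ∈ : ∀ u → φ u ∈ˢ S′
    φ∈ u with T? (S′ u)
    ... | yes u∈ = subst (_∈ˢ S′) (≡.sym (redirect-in S′ h u∈)) u∈
    ... | no u∉ = subst (_∈ˢ S′) (≡.sym (redirect-out S′ h u∉)) h∈
    edge : ∀ {u v} → u ∈ˢ S → v ∈ˢ S → u ~ v → Conn (_∈ˢ S′) (φ u) (φ v)
    edge {u} {v} u∈S v∈S e with T? (S′ u) | T? (S′ v)
    ... | yes u∈ | yes v∈ =
      ≡.subst₂ (Conn (_∈ˢ S′)) (≡.sym (redirect-in S′ h u∈)) (≡.sym (redirect-in S′ h v∈))
        (u∈ ∷⟨ e ⟩ ∎ v∈)
    ... | yes u∈ | no v∉ =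
      ≡.subst₂ (Conn (_∈ˢ S′)) (≡.sym (redirect-in S′ h u∈)) (≡.sym (redirect-out S′ h v∉))
        (hub v∈S v∉ u∈ (~-sym e))
    ... | no u∉ | yes v∈ =
      ≡.subst₂ (Conn (_∈ˢ S′)) (≡.sym (redirect-out S′ h u∉)) (≡.sym (redirect-in S′ h v∈))
        (Conn-sym (hub u∈S u∉ v∈ e))
    ... | no u∉ | no v∉ =
      ≡.subst₂ (Conn (_∈ˢ S′)) (≡.sym (redirect-out S′ h u∉)) (≡.sym (redirect-out S′ h v∉))
        (∎ h∈)
    walk : ∀ {u v} → Conn (_∈ˢ S) u v → Conn (_∈ˢ S′) (φ u) (φ v)
    walk {u} (∎ _) = ∎ φ∈ u
    walk (p ∷⟨ e ⟩ c) = Conn-trans (edge p (Conn-source c) e) (walk c)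

  -- No edge joins `S′` to the rest of `S`, so every walk stays on its side. The representatives
  -- inside `S′` therefore still cover `S′`, and the representative of `v` is dropped.
  cover-component : ∀ {S S′ v L} → v ∈ˢ S → ¬ v ∈ˢ S′ → S′ ⊆ˢ S →
    (∀ {x y} → x ∈ˢ S → ¬ x ∈ˢ S′ → y ∈ˢ S′ → ¬ x ~ y) →
    Cover S L → ∃ λ L′ → Cover S′ L′ × length L′ < length L
  cover-component {S} {S′} {v} {L} v∈ v∉ sub sep cov =
    filter (T? ∘ S′) L , cov′ , filter-notAll (T? ∘ S′) L outside
    where
    stay-out : ∀ {x y} → Conn (_∈ˢ S) x y → ¬ x ∈ˢ S′ → ¬ y ∈ˢ S′
    stay-out (∎ _) x∉ = x∉
    stay-out (x∈ ∷⟨ e ⟩ c) x∉ = stay-out c λ y∈ → sep x∈ x∉ y∈ e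
    stay-in : ∀ {x y} → Conn (_∈ˢ S) x y → x ∈ˢ S′ → Conn (_∈ˢ S′) x y
    stay-in (∎ _) x∈ = ∎ x∈
    stay-in (_∷⟨_⟩_ {y = y} _ e c) x∈ with T? (S′ y)
    ... | yes y∈ = x∈ ∷⟨ e ⟩ stay-in c y∈
    ... | no y∉ = contradiction (~-sym e) (sep (Conn-source c) y∉ x∈)
    outside : Any (λ ℓ → ¬ ℓ ∈ˢ S′) L
    outside with cov v∈
    ... | ℓ , ℓ∈ , c = Any.map (λ { refl → stay-out c v∉ }) ℓ∈
    cov′ : Cover S′ (filter (T? ∘ S′) L)
    cov′ x∈ with cov (sub x∈)
    ... | ℓ , ℓ∈ , c = ℓ , ∈-filter⁺ (T? ∘ S′) ℓ∈ (Conn-target (stay-in c x∈)) , stay-in c x∈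

  full : VSet n
  full _ = true

  reachW-sound : ∀ t {u v} → T (reachW (adj G) t u v) → Conn (_∈ˢ full) u v
  reachW-sound zero {u} {v} r with refl ← toWitness {a? = u ≟ v} r = ∎ tt
  reachW-sound (suc t) {u} {v} r with Equivalence.to (T-∨ {reachW (adj G) t u v}) r
  ... | inj₁ r′ = reachW-sound t r′
  ... | inj₂ r′ with Any.satisfied (Any.any⁻ (λ w → reachW (adj G) t u w ∧ adj G w v) (allFin n) r′)
  ... | w , p with ∧-elim {reachW (adj G) t u w} p
  ... | q , e = Conn-trans (reachW-sound t q) (tt ∷⟨ e ⟩ ∎ tt)

  -- Moving from a vertex to a smaller one that reaches it must stop, and it stops at one of the
  -- vertices counted by `components`.
  components-cover : ∃ λ L → Cover full L × length L ≡ components G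
  components-cover = elements leastIn , (λ {x} _ → go x (FinInd.<-wellFounded x)) , refl
    where
    import Data.Fin.Induction as FinInd
    open import Induction.WellFounded using (Acc; acc)
    below : Fin n → Fin n → Bool
    below v u = ⌊ u <? v ⌋ ∧ reach G u v
    leastIn : VSet n
    leastIn v = not (any (below v) (allFin n))
    go : ∀ x → Acc Fin._<_ x → ∃ λ ℓ → ℓ ∈ elements leastIn × Conn (_∈ˢ full) x ℓ
    go x (acc rec) with T? (any (below x) (allFin n))
    ... | no ¬b = x , elements⁺ leastIn (not⁺ ¬b) , ∎ tt
    ... | yes b with Any.satisfied (Any.any⁻ (below x) (allFin n) b)
    ... | u , p with ∧-elim {⌊ u <? x ⌋} p
    ... | u<x , r with go u (rec (toWitness u<x))
    ... | ℓ , ℓ∈ , c = ℓ , ℓ∈ , Conn-trans (Conn-sym (reachW-sound n r)) c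

  -- Induced cycles

  cycle1 : VSet n → Bool
  cycle1 C = isInducedCycle G C ∧ ⌊ ∣ C ∣ % 3 Data.Nat.≟ 1 ⌋

  cycleIn : VSet n → VSet n → Bool
  cycleIn S C = cycle1 C ∧ subset C S

  -- The induced cycles of `G[S]` are those of `G` contained in `S`, so no induced graph has to be
  -- constructed.
  c₁In : VSet n → ℕ
  c₁In S = length (filter (λ C → Data.Bool._≟_ (cycleIn S C) true) (allVSets n))

  cycleIn-mono : ∀ {S S′} → S ⊆ˢ S′ → ∀ {C} → T (cycleIn S C) → T (cycleIn S′ C)
  cycleIn-mono {S} {S′} sub {C} t with ∧-elim {cycle1 C} t
  ... | cyc , s = ∧-intro cyc (subset⁺ {C = C} {S′} (λ x∈ → sub (subset⁻ {C = C} {S} s x∈)))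

  c₁In-mono : ∀ {S S′} → S ⊆ˢ S′ → c₁In S ≤ c₁In S′
  c₁In-mono {S} {S′} sub = length-filter-mono {p = cycleIn S} {cycleIn S′} (λ {C} → cycleIn-mono sub {C}) (allVSets n)

  c₁In≤c₁ : ∀ S → c₁In S ≤ c₁ G
  c₁In≤c₁ S = length-filter-mono {p = cycleIn S} {cycle1} (λ {C} t → proj₁ (∧-elim {cycle1 C} t)) (allVSets n)

  c₁In-strict : ∀ {S S′ v C} → S ⊆ˢ S′ → C ∈ allVSets n → T (cycle1 C) → C ⊆ˢ S′ → v ∈ˢ C → ¬ v ∈ˢ S →
    c₁In S < c₁In S′
  c₁In-strict {S} {S′} {v} {C} sub C∈ cyc C⊆ v∈ v∉ =
    length-filter-strict {p = cycleIn S} {cycleIn S′} (λ {C} → cycleIn-mono sub {C}) C∈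
      (∧-intro cyc (subset⁺ {C = C} {S′} C⊆))
      (λ t → v∉ (subset⁻ {C = C} {S} (proj₂ (∧-elim {cycle1 C} t)) v∈))

  record Between (S : VSet n) (p x q : Fin n) : Set where
    constructor between
    field
      prev     : x ~ p
      succ     : x ~ q
      distinct : p ≢ q
      only     : ∀ {y} → y ∈ˢ S → x ~ y → y ≡ p ⊎ y ≡ q
  open Between

  next : List (Fin n) → Fin n → Fin n
  next [] a = a
  next (x ∷ _) a = x

  -- Chain S p xs a: the sequence p , xs , a is a walk all of whose inner vertices xs have degree two in S.
  data Chain (S : VSet n) : Fin n → List (Fin n) → Fin n → Set where
    []  : ∀ {p a} → Chain S p [] a
    _∷_ : ∀ {p x xs a} → Between S p x (next xs a) → Chain S x xs a → Chain S p (x ∷ xs) a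

  chain-between : ∀ {S p xs a} → Chain S p xs a → ∀ {u} → u ∈ xs →
    ∃₂ λ q r → Between S q u r × q ∈ p ∷ xs × (r ∈ xs ⊎ r ≡ a)
  chain-between {xs = x ∷ []} (b ∷ _) (here refl) = _ , _ , b , here refl , inj₂ refl
  chain-between {xs = x ∷ y ∷ _} (b ∷ _) (here refl) = _ , _ , b , here refl , inj₁ (there (here refl))
  chain-between (_ ∷ c) (there u∈) with chain-between c u∈
  ... | q , r , b , q∈ , inj₁ r∈ = q , r , b , there q∈ , inj₁ (there r∈)
  ... | q , r , b , q∈ , inj₂ r≡ = q , r , b , there q∈ , inj₂ r≡

  -- A chain vertex adjacent to `a` has `a` as predecessor or successor. As `a` is neither `p` nor
  -- in the chain, only the last vertex qualifies. For a closed chain this supplies the second cycle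
  -- neighbour of the vertex where it closes.
  chain-last : ∀ {S p x xs a} → Chain S p (x ∷ xs) a → p ≢ a → a ∉ x ∷ xs → a ∈ˢ S →
    ∃ λ ℓ → ℓ ∈ x ∷ xs × ℓ ~ a × (∀ {y} → y ∈ x ∷ xs → y ~ a → y ≡ ℓ)
  chain-last {x = x} {[]} (b ∷ _) p≢a a∉ a∈S = x , here refl , succ b , λ { (here refl) _ → refl }
  chain-last {x = x} {x′ ∷ xs} (b ∷ c) p≢a a∉ a∈S with chain-last c (a∉ ∘ here ∘ ≡.sym) (a∉ ∘ there) a∈S
  ... | ℓ , ℓ∈ , ℓ~a , uniq = ℓ , there ℓ∈ , ℓ~a , λ where
    (there y∈) y~a → uniq y∈ y~a
    (here refl) x~a → [ (λ a≡p → contradiction (≡.sym a≡p) p≢a) , (λ a≡x′ → contradiction (there (here a≡x′)) a∉) ]′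
      (only b a∈S x~a)

  degIn≡2 : ∀ C u {a b} → a ≢ b → a ∈ˢ C → b ∈ˢ C → u ~ a → u ~ b →
    (∀ {y} → y ∈ˢ C → u ~ y → y ≡ a ⊎ y ≡ b) → degIn G C u ≡ 2
  degIn≡2 C u {a} {b} a≢b a∈ b∈ u~a u~b only₂ = ℕ.≤-antisym
    (∣∣≤length N {a ∷ b ∷ []} λ y∈ → let y∈C , u~y = ∧-elim {C _} y∈ in
      [ here , there ∘ here ]′ (only₂ y∈C u~y))
    (length≤∣∣ N ((a≢b ∷ []) ∷ [] ∷ []) λ { (here refl) → ∧-intro a∈ u~a ; (there (here refl)) → ∧-intro b∈ u~b })
    where
    N : VSet n
    N y = C y ∧ adj G u y

  chain-linked : ∀ {S p xs a} (C : VSet n) → Chain S p xs a → (∀ {z} → z ∈ p ∷ xs → z ∈ˢ C) →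
    Linked (λ x y → T (C x ∧ C y ∧ adj G x y) × T (C y ∧ C x ∧ adj G y x)) (p ∷ xs)
  chain-linked C [] f = [-]
  chain-linked C (b ∷ c) f =
    (∧-intro p∈ (∧-intro x∈ (~-sym (prev b))) , ∧-intro x∈ (∧-intro p∈ (prev b))) ∷ chain-linked C c (f ∘ there)
    where
    p∈ = f (here refl)
    x∈ = f (there (here refl))

  -- Inner vertices have degree two even in `S`. The closing vertex `v` may have further neighbours
  -- in `S`, but inside `C` it sees only the two ends of the chain. It also adds one to the length,
  -- which turns residue 0 into 1.
  closedChain-cycle : ∀ {S v x xs C} → Chain S v (x ∷ xs) v → Unique (v ∷ x ∷ xs) → C ⊆ˢ S →
    (∀ {z} → z ∈ v ∷ x ∷ xs → z ∈ˢ C) → (∀ {z} → z ∈ˢ C → z ∈ v ∷ x ∷ xs) →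
    length (x ∷ xs) % 3 ≡ 0 → T (cycle1 C)
  -- A single inner vertex would have `v` as both of its distinct neighbours, so the cycle has at
  -- least three vertices.
  closedChain-cycle {xs = []} (b ∷ _) _ _ _ _ _ = contradiction refl (distinct b)
  closedChain-cycle {S} {v} {x} {x′ ∷ xs} {C} ch@(b ∷ c) u@(v∉ ∷ x∉ ∷ _) C⊆ to from mod =
    ∧-intro {isInducedCycle G C}
      (∧-intro (fromWitness {a? = 3 Data.Nat.≤? ∣ C ∣} 3≤)
        (∧-intro (all-Fin⁺ _ λ y → imp⁺ {C y} (λ y∈ → fromWitness (regular y∈)))
          (all-Fin⁺ _ λ y → all-Fin⁺ _ λ z → imp⁺ {C y ∧ C z} (connected y z))))
      (fromWitness {a? = ∣ C ∣ % 3 Data.Nat.≟ 1} mod′)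
    where
    size : ∣ C ∣ ≡ length (v ∷ x ∷ x′ ∷ xs)
    size = ℕ.≤-antisym (∣∣≤length C from) (length≤∣∣ C u to)
    3≤ : 3 ≤ ∣ C ∣
    3≤ = subst (3 ≤_) (≡.sym size) (s≤s (s≤s (s≤s z≤n)))
    mod′ : ∣ C ∣ % 3 ≡ 1
    mod′ = ≡.trans (cong (_% 3) size)
      (≡.trans (%-distribˡ-+ 1 (length (x ∷ x′ ∷ xs)) 3) (cong (λ r → (1 + r) % 3) mod))
    v∈S : v ∈ˢ S
    v∈S = C⊆ (to (here refl))
    x≢v : x ≢ v
    x≢v x≡v = All.lookup v∉ (here refl) (≡.sym x≡v)
    regular : ∀ {y} → y ∈ˢ C → degIn G C y ≡ 2
    regular y∈ with from y∈
    regular y∈ | there y∈xs with chain-between ch y∈xs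
    ... | q , r , b′ , q∈ , r∈ = degIn≡2 C _ (distinct b′) (to q∈) (to ([ there , here ]′ r∈)) (prev b′) (succ b′)
      (only b′ ∘ C⊆)
    regular y∈ | here refl with chain-last c x≢v (λ v∈ → All.lookup v∉ (there v∈) refl) v∈S
    ... | ℓ , ℓ∈ , ℓ~v , uniq = degIn≡2 C v (All.lookup x∉ ℓ∈) (to (there (here refl))) (to (there (there ℓ∈)))
      (~-sym (prev b)) (~-sym ℓ~v) only-v
      where
      only-v : ∀ {y} → y ∈ˢ C → v ~ y → y ≡ x ⊎ y ≡ ℓ
      only-v y∈ v~y with from y∈
      ... | here refl = contradiction refl (~-irrefl v~y)
      ... | there (here refl) = inj₁ refl
      ... | there (there y∈xs) = inj₂ (uniq y∈xs (~-sym v~y))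
    connected : ∀ y z → T (C y ∧ C z) → T (reachW (λ x y → C x ∧ C y ∧ adj G x y) n y z)
    connected y z yz = let y∈ , z∈ = ∧-elim {C y} yz in
      -- The path needs one step fewer than the size of `C`, which is at most `n`.
      reachW-mono _ y z (≤-trans (ℕ.≤-trans (ℕ.n≤1+n _) (ℕ.≤-reflexive (≡.sym size))) (∣∣≤n C))
        (reachW-linked _ (chain-linked C ch to) (from y∈) (from z∈))

  -- Deleting `v` destroys the cycle through it; this is the extra unit for cycles of length 1
  -- modulo 3.
  closedChain-c₁ : ∀ {S S′ v x xs} → Chain S v (x ∷ xs) v → Unique (v ∷ x ∷ xs) →
    (∀ {z} → z ∈ v ∷ x ∷ xs → z ∈ˢ S) → length (x ∷ xs) % 3 ≡ 0 → S′ ⊆ˢ S → ¬ v ∈ˢ S′ → c₁In S′ < c₁In S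
  closedChain-c₁ {S} {S′} {v} {x} {xs} ch u sub mod S′⊆ v∉
    with allVSets-complete (λ y → ⌊ y ∈? (v ∷ x ∷ xs) ⌋)
  ... | C , C∈ , eq = c₁In-strict {S′} {S} {v} {C} S′⊆ C∈ (closedChain-cycle {S} {C = C} ch u (sub ∘ from) to from mod)
      (sub ∘ from) (to (here refl)) v∉
    where
    to : ∀ {z} → z ∈ v ∷ x ∷ xs → z ∈ˢ C
    to {z} z∈ = subst T (≡.sym (eq z)) (fromWitness z∈)
    from : ∀ {z} → z ∈ˢ C → z ∈ v ∷ x ∷ xs
    from {z} z∈ = toWitness (subst T (eq z) z∈)

  -- Dissociation sets and the peeling of paths

  -- Maximum degree at most one, in the form that two neighbours coincide. Using predicates instead
  -- of Boolean sets makes unions of mutually non-adjacent parts immediate.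
  Diss : (Fin n → Set) → Set
  Diss P = ∀ {c a b} → P c → P a → P b → c ~ a → c ~ b → a ≡ b

  Diss-⊎ : ∀ {P Q : Fin n → Set} → Diss P → Diss Q → (∀ {x y} → P x → Q y → ¬ x ~ y) → Diss (λ x → P x ⊎ Q x)
  Diss-⊎ dP dQ sep (inj₁ c) (inj₁ a) (inj₁ b) e f = dP c a b e f
  Diss-⊎ dP dQ sep (inj₁ c) (inj₂ a) _ e f = contradiction e (sep c a)
  Diss-⊎ dP dQ sep (inj₁ c) (inj₁ a) (inj₂ b) e f = contradiction f (sep c b)
  Diss-⊎ dP dQ sep (inj₂ c) (inj₂ a) (inj₂ b) e f = dQ c a b e f
  Diss-⊎ dP dQ sep (inj₂ c) (inj₁ a) _ e f = contradiction (~-sym e) (sep a c)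
  Diss-⊎ dP dQ sep (inj₂ c) (inj₂ a) (inj₁ b) e f = contradiction (~-sym f) (sep b c)

  Diss-⊆ : ∀ {P Q : Fin n → Set} → (∀ {x} → P x → Q x) → Diss Q → Diss P
  Diss-⊆ f d c a b = d (f c) (f a) (f b)

  Diss-pair : ∀ x y → Diss (λ z → z ≡ x ⊎ z ≡ y)
  Diss-pair x y _ (inj₁ refl) (inj₁ refl) _ _ = refl
  Diss-pair x y _ (inj₂ refl) (inj₂ refl) _ _ = refl
  Diss-pair x y (inj₁ refl) (inj₁ refl) (inj₂ refl) e _ = contradiction refl (~-irrefl e)
  Diss-pair x y (inj₂ refl) (inj₁ refl) (inj₂ refl) _ f = contradiction refl (~-irrefl f)
  Diss-pair x y (inj₁ refl) (inj₂ refl) (inj₁ refl) _ f = contradiction refl (~-irrefl f)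
  Diss-pair x y (inj₂ refl) (inj₂ refl) (inj₁ refl) e _ = contradiction refl (~-irrefl e)

  Diss⇒IsDissociationSet : ∀ {D} → Diss (_∈ˢ D) → IsDissociationSet G D
  Diss⇒IsDissociationSet {D} d v v∈ = atMostOne (elements-unique N)
    λ a∈ b∈ → let a∈D , v~a = ∧-elim {D _} (elements⁻ N a∈)
                  b∈D , v~b = ∧-elim {D _} (elements⁻ N b∈)
              in d v∈ a∈D b∈D v~a v~b
    where
    N : VSet n
    N u = D u ∧ adj G v u
    atMostOne : ∀ {xs : List (Fin n)} → Unique xs → (∀ {a b} → a ∈ xs → b ∈ xs → a ≡ b) → length xs ≤ 1
    atMostOne {[]} _ _ = z≤n
    atMostOne {_ ∷ []} _ _ = s≤s z≤n
    atMostOne {_ ∷ _ ∷ _} ((x≢y ∷ _) ∷ _) eq = contradiction (eq (here refl) (there (here refl))) x≢y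

  -- Deleting xs from R one vertex at a time destroys at least w edges; the neighbours of a deleted
  -- vertex other than its successor and earlier vertices satisfy P.
  data Peel (R : VSet n) (P : Fin n → Set) : List (Fin n) → ℕ → Set where
    []   : Peel R P [] 0
    peel : ∀ {x xs w} ns → x ∈ˢ R → Unique ns → (∀ {y} → y ∈ ns → y ∈ˢ R × x ~ y) →
           (∀ {y} → y ∈ˢ R → x ~ y → P y ⊎ y ∈ take 1 xs) →
           Peel (del R x) P xs w → Peel R P (x ∷ xs) (length ns + w)

  peel-⊆ : ∀ {R P xs w} → Peel R P xs w → ∀ {x} → x ∈ xs → x ∈ˢ R
  peel-⊆ (peel _ x∈ _ _ _ _) (here refl) = x∈
  peel-⊆ {R} (peel _ _ _ _ _ pl) (there y∈) = proj₁ (del⁻ R (peel-⊆ pl y∈))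

  peel-unique : ∀ {R P xs w} → Peel R P xs w → Unique xs
  peel-unique [] = []
  peel-unique {R} (peel _ _ _ _ _ pl) =
    All.tabulate (λ { y∈ refl → proj₂ (del⁻ R (peel-⊆ pl y∈)) refl }) ∷ peel-unique pl

  peel-E : ∀ {R P xs w} → Peel R P xs w → E (R ∖ xs) + w ≤ E R
  peel-E {R} [] = ℕ.≤-reflexive (ℕ.+-identityʳ (E R))
  peel-E {R} {xs = x ∷ xs} (peel {w = w} ns x∈ u nbr _ pl) = begin
    E (del R x ∖ xs) + (length ns + w) ≡⟨ cong (E (del R x ∖ xs) +_) (ℕ.+-comm (length ns) w) ⟩
    E (del R x ∖ xs) + (w + length ns) ≡⟨ ℕ.+-assoc (E (del R x ∖ xs)) w (length ns) ⟨
    E (del R x ∖ xs) + w + length ns   ≤⟨ ℕ.+-monoˡ-≤ (length ns) (peel-E pl) ⟩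
    E (del R x) + length ns            ≤⟨ E-del R x∈ u nbr ⟩
    E R                                ∎
    where open ≤-Reasoning

  -- Since `y` is never deleted, it is still present when `x` is, so the condition recorded at that
  -- moment applies to it; being outside `xs`, `y` is not the successor.
  peel-closed : ∀ {R P xs w} → Peel R P xs w → ∀ {x y} → x ∈ xs → y ∈ˢ R → y ∉ xs → x ~ y → P y
  peel-closed {xs = _ ∷ xs} (peel _ _ _ _ cl _) (here refl) y∈ y∉ e with cl y∈ e
  ... | inj₁ py = py
  ... | inj₂ y∈xs = contradiction (there (take₁⊆ xs y∈xs)) y∉
  peel-closed {R} (peel _ _ _ _ _ pl) (there x∈) y∈ y∉ e =
    peel-closed pl x∈ (del⁺ R y∈ (y∉ ∘ here)) (y∉ ∘ there) e

  -- Within `xs`, the only later neighbour of a vertex can be its successor. Hence `x` and `y` see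
  -- nothing beyond `z`, which is discarded, and the first block is not adjacent to the rest.
  keep-diss : ∀ {R P xs w} → Peel R P xs w → (∀ {x} → x ∈ xs → ¬ P x) → Diss (_∈ keep xs)
  keep-diss {xs = []} _ _ () _ _
  keep-diss {xs = x ∷ []} _ _ = Diss-⊆ (λ { (here eq) → inj₁ eq }) (Diss-pair x x)
  keep-diss {xs = x ∷ y ∷ []} _ _ =
    Diss-⊆ (λ { (here eq) → inj₁ eq ; (there (here eq)) → inj₂ eq }) (Diss-pair x y)
  keep-diss {R} {P} {x ∷ y ∷ z ∷ xs} pl@(peel _ _ _ _ clx ply@(peel _ _ _ _ cly (peel _ _ _ _ _ plz))) ¬P =
    Diss-⊆ (λ { (here eq) → inj₁ (inj₁ eq) ; (there (here eq)) → inj₁ (inj₂ eq) ; (there (there z∈)) → inj₂ z∈ })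
      (Diss-⊎ (Diss-pair x y) (keep-diss plz (¬P ∘ there ∘ there ∘ there)) sep)
    where
    sep : ∀ {u v} → u ≡ x ⊎ u ≡ y → v ∈ keep xs → ¬ u ~ v
    sep {v = v} (inj₁ refl) v∈ e with keep-⊆ xs v∈ | peel-unique ply
    ... | v∈xs | (_ ∷ y∉) ∷ _ with clx (peel-⊆ pl (there (there (there v∈xs)))) e
    ... | inj₁ pv = ¬P (there (there (there v∈xs))) pv
    ... | inj₂ (here refl) = All.lookup y∉ v∈xs refl
    sep {v = v} (inj₂ refl) v∈ e with keep-⊆ xs v∈ | peel-unique ply
    ... | v∈xs | _ ∷ z∉ ∷ _ with cly (peel-⊆ ply (there (there v∈xs))) e
    ... | inj₁ pv = ¬P (there (there (there v∈xs))) pv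
    ... | inj₂ (here refl) = All.lookup z∉ v∈xs refl

  -- The theorem for `G[S]`, cleared of the fraction. It is claimed for every cover, so that the
  -- cover left by a deletion can be fed to the induction hypothesis.
  Good : VSet n → Set
  Good S = ∀ {L} → Cover S L → Σ (VSet n) λ D → D ⊆ˢ S × Diss (_∈ˢ D) ×
    3 * ∣ S ∣ ≤ 3 * ∣ D ∣ + (E S + length L + c₁In S)

  -- The general reduction step: the set obtained for `S′` is enlarged by `Y`. The numerical
  -- hypothesis says that three times the vertices lost is paid for by `Y` together with the lost
  -- edges, representatives and cycles.
  extend : ∀ {S S′} {L L′ : List (Fin n)} Y → Good S′ → Cover S′ L′ → S′ ⊆ˢ S → Unique Y →
    (∀ {y} → y ∈ Y → y ∈ˢ S × ¬ y ∈ˢ S′) → Diss (_∈ Y) → (∀ {y t} → y ∈ Y → t ∈ˢ S′ → ¬ y ~ t) →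
    3 * ∣ S ∣ + (E S′ + length L′ + c₁In S′) ≤ 3 * ∣ S′ ∣ + (3 * length Y + (E S + length L + c₁In S)) →
    Σ (VSet n) λ D → D ⊆ˢ S × Diss (_∈ˢ D) × 3 * ∣ S ∣ ≤ 3 * ∣ D ∣ + (E S + length L + c₁In S)
  extend {S} {S′} {L} {L′} Y good cov S′⊆ Y-unique Y-out Y-diss Y-sep num with good cov
  ... | D′ , D′⊆ , D′-diss , bound = D , D⊆ , Diss-⊆ D⁻ D-diss ,
      arith (3 * ∣ S ∣) (E S′ + length L′ + c₁In S′) (3 * ∣ S′ ∣) (3 * ∣ D′ ∣) (3 * ∣ D ∣) (E S + length L + c₁In S)
        (3 * length Y) num bound size
    where
    D : VSet n
    D u = D′ u ∨ ⌊ u ∈? Y ⌋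
    D⁻ : ∀ {u} → u ∈ˢ D → u ∈ˢ D′ ⊎ u ∈ Y
    D⁻ {u} u∈ with Equivalence.to (T-∨ {D′ u}) u∈
    ... | inj₁ u∈D′ = inj₁ u∈D′
    ... | inj₂ u∈Y = inj₂ (toWitness u∈Y)
    D⊆ : D ⊆ˢ S
    D⊆ {u} u∈ = [ S′⊆ ∘ D′⊆ , proj₁ ∘ Y-out ]′ (D⁻ {u} u∈)
    D-diss : Diss (λ u → u ∈ˢ D′ ⊎ u ∈ Y)
    D-diss = Diss-⊎ {_∈ˢ D′} D′-diss Y-diss λ x∈ y∈ e → Y-sep y∈ (D′⊆ x∈) (~-sym e)
    size : 3 * ∣ D′ ∣ + 3 * length Y ≤ 3 * ∣ D ∣
    size = begin
      3 * ∣ D′ ∣ + 3 * length Y ≡⟨ ℕ.*-distribˡ-+ 3 ∣ D′ ∣ (length Y) ⟨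
      3 * (∣ D′ ∣ + length Y)   ≡⟨ cong (3 *_) (length-++ (elements D′)) ⟨
      3 * length (elements D′ ++ Y)
        ≤⟨ ℕ.*-monoʳ-≤ 3 (length≤∣∣ D
             (Unique.++⁺ (elements-unique D′) Y-unique λ (x∈ , x∈Y) → proj₂ (Y-out x∈Y) (D′⊆ (elements⁻ D′ x∈)))
             λ {x} x∈ → Equivalence.from (T-∨ {D′ x})
               ([ inj₁ ∘ elements⁻ D′ , inj₂ ∘ fromWitness ]′ (∈-++⁻ (elements D′) x∈))) ⟩
      3 * ∣ D ∣ ∎
      where open ≤-Reasoning
    arith : ∀ s r s′ d′ d q y → s + r ≤ s′ + (y + q) → s′ ≤ d′ + r → d′ + y ≤ d → s ≤ d + q
    arith s r s′ d′ d q y p₁ p₂ p₃ = ℕ.+-cancelʳ-≤ r s (d + q) (begin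
      s + r              ≤⟨ p₁ ⟩
      s′ + (y + q)       ≤⟨ ℕ.+-monoˡ-≤ (y + q) p₂ ⟩
      d′ + r + (y + q)   ≡⟨ shuffle d′ r y q ⟩
      d′ + y + q + r     ≤⟨ ℕ.+-monoˡ-≤ r (ℕ.+-monoˡ-≤ q p₃) ⟩
      d + q + r          ∎)
      where
      open ≤-Reasoning
      shuffle : ∀ d′ r y q → d′ + r + (y + q) ≡ d′ + y + q + r
      shuffle = solve-∀

  -- Depth-first search

  module Search (S : VSet n) (ih : ∀ S′ → ∣ S′ ∣ < ∣ S ∣ → Good S′) where

    -- The vertex v is being visited, A is the stack of its ancestors and U is the set of unvisited vertices.
    record Frame (v : Fin n) (A : List (Fin n)) (U : VSet n) : Set where
      field
        v∈S    : v ∈ˢ S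
        A⊆S    : ∀ {a} → a ∈ A → a ∈ˢ S
        U⊆S    : U ⊆ˢ S
        v∉A    : v ∉ A
        v∉U    : ¬ v ∈ˢ U
        A∩U    : ∀ {x} → x ∈ A → ¬ x ∈ˢ U
        linked : Linked _~_ (v ∷ A)
        closed : ∀ {x y} → x ∈ˢ U → y ∈ˢ S → x ~ y → y ∈ v ∷ A ⊎ y ∈ˢ U

    -- The irreducible shapes of a finished subtree below v: a pendant path with one or two vertices, or a path
    -- that leads back to v or to an ancestor a of v.
    data Piece (v : Fin n) (A : List (Fin n)) (U : VSet n) : Set where
      one : ∀ x → x ∈ˢ U → x ~ v → (∀ {y} → y ∈ˢ S → x ~ y → y ≡ v) → Piece v A U
      two : ∀ x y → x ∈ˢ U → y ∈ˢ U → Between S v x y → (∀ {z} → z ∈ˢ S → y ~ z → z ≡ x) → Piece v A U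
      arc : ∀ x xs a → (∀ {z} → z ∈ x ∷ xs → z ∈ˢ U) → Unique (x ∷ xs) → Chain S v (x ∷ xs) a → a ∈ v ∷ A → Piece v A U

    verts : ∀ {v A U} → Piece v A U → List (Fin n)
    verts (one x _ _ _) = x ∷ []
    verts (two x y _ _ _ _) = x ∷ y ∷ []
    verts (arc x xs _ _ _ _ _) = x ∷ xs

    verts⊆ : ∀ {v A U} (π : Piece v A U) → ∀ {z} → z ∈ verts π → z ∈ˢ U
    verts⊆ (one x x∈ _ _) (here refl) = x∈
    verts⊆ (two x y x∈ y∈ _ _) (here refl) = x∈
    verts⊆ (two x y x∈ y∈ _ _) (there (here refl)) = y∈
    verts⊆ (arc _ _ _ sub _ _ _) z∈ = sub z∈

    verts-closed : ∀ {v A U} (π : Piece v A U) → ∀ {x y} → x ∈ verts π → y ∈ˢ S → x ~ y → y ∈ v ∷ A ⊎ y ∈ verts π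
    verts-closed (one _ _ _ cl) (here refl) y∈ e = inj₁ (here (cl y∈ e))
    verts-closed (two _ _ _ _ b cl) (here refl) y∈ e with only b y∈ e
    ... | inj₁ eq = inj₁ (here eq)
    ... | inj₂ eq = inj₂ (there (here eq))
    verts-closed (two _ _ _ _ b cl) (there (here refl)) y∈ e = inj₂ (here (cl y∈ e))
    verts-closed (arc x xs a _ _ ch a∈) x∈ y∈ e with chain-between ch x∈
    ... | q , r , b , q∈ , r∈ with only b y∈ e
    verts-closed (arc x xs a _ _ ch a∈) x∈ y∈ e | q , r , b , here refl , r∈ | inj₁ refl = inj₁ (here refl)
    verts-closed (arc x xs a _ _ ch a∈) x∈ y∈ e | q , r , b , there q∈ , r∈ | inj₁ refl = inj₂ q∈
    verts-closed (arc x xs a _ _ ch a∈) x∈ y∈ e | q , r , b , q∈ , inj₁ r∈ | inj₂ refl = inj₂ r∈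
    verts-closed (arc x xs a _ _ ch a∈) x∈ y∈ e | q , r , b , q∈ , inj₂ refl | inj₂ refl = inj₁ a∈

    -- The neighbours of a piece lie on the stack or in the piece, so no remaining unvisited vertex
    -- is adjacent to it.
    shrink : ∀ {v A U} → Frame v A U → (π : Piece v A U) → Frame v A (U ∖ verts π)
    shrink {v} {A} {U} F π = record
      { v∈S = v∈S ; A⊆S = A⊆S ; U⊆S = U⊆S ∘ old ; v∉A = v∉A ; v∉U = v∉U ∘ old
      ; A∩U = λ x∈ → A∩U x∈ ∘ old ; linked = linked ; closed = closed′ }
      where
      open Frame F
      old : ∀ {x} → x ∈ˢ U ∖ verts π → x ∈ˢ U
      old x∈ = proj₁ (∖⁻ U (verts π) x∈)
      closed′ : ∀ {x y} → x ∈ˢ U ∖ verts π → y ∈ˢ S → x ~ y → y ∈ v ∷ A ⊎ y ∈ˢ U ∖ verts π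
      closed′ {x} {y} x∈ y∈ e with closed (old x∈) y∈ e
      ... | inj₁ y∈A = inj₁ y∈A
      ... | inj₂ y∈U with y ∈? verts π
      ... | no y∉ = inj₂ (∖⁺ U (verts π) y∈U y∉)
      ... | yes y∈π with verts-closed π y∈π (U⊆S (old x∈)) (~-sym e)
      ... | inj₁ (here refl) = contradiction (old x∈) v∉U
      ... | inj₁ (there x∈A) = contradiction (old x∈) (A∩U x∈A)
      ... | inj₂ x∈π = contradiction x∈π (proj₂ (∖⁻ U (verts π) x∈))

    -- The effect of the finished subtrees below v once v is deleted: those not attached to the stack are removed
    -- (the vertices of S outside R) and contribute Y to the dissociation set, the others are entered through heads.
    record Gain (v : Fin n) (A : List (Fin n)) (U : VSet n) (g : ℕ) : Set where
      field
        R            : VSet n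
        R⊆S          : R ⊆ˢ S
        U⊆R          : U ⊆ˢ R
        A⊆R          : ∀ {a} → a ∈ A → a ∈ˢ R
        v∈R          : v ∈ˢ R
        closed       : ∀ {x y} → x ∈ˢ S → ¬ x ∈ˢ R → y ∈ˢ R → x ~ y → y ≡ v
        Y            : List (Fin n)
        Y-unique     : Unique Y
        Y-out        : ∀ {y} → y ∈ Y → y ∈ˢ S × ¬ y ∈ˢ R
        Y-diss       : Diss (_∈ Y)
        slack        : ℕ
        bound        : 3 * ∣ S ∣ + (slack + E R) ≤ 3 * ∣ R ∣ + (3 * length Y + E S)
        heads        : List (Fin n)
        heads-unique : Unique heads
        heads-adj    : ∀ {h} → h ∈ heads → v ~ h
        heads∉A      : ∀ {h} → h ∈ heads → h ∉ A
        heads-conn   : ∀ {h} → h ∈ heads → ∃ λ a → a ∈ A × Conn (λ x → x ∈ˢ R × ¬ x ∈ˢ U × x ≢ v) h a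
        v-nbrs       : ∀ {y} → y ∈ˢ R → v ~ y → y ∈ A ⊎ y ∈ˢ U ⊎ y ∈ heads
        total        : g ≤ slack + length heads

    -- Gains of finished subtrees

    gain₀ : ∀ {v A U} → Frame v A U → (∀ {y} → y ∈ˢ S → v ~ y → y ∈ A ⊎ y ∈ˢ U) → Gain v A U 0
    gain₀ F nbrs = record
      { R = S ; R⊆S = id ; U⊆R = U⊆S ; A⊆R = A⊆S ; v∈R = v∈S ; closed = λ x∈ x∉ → contradiction x∈ x∉
      ; Y = [] ; Y-unique = [] ; Y-out = λ () ; Y-diss = λ () ; slack = 0 ; bound = ≤-refl
      ; heads = [] ; heads-unique = [] ; heads-adj = λ () ; heads∉A = λ () ; heads-conn = λ ()
      ; v-nbrs = λ y∈ e → [ inj₁ , inj₂ ∘ inj₁ ]′ (nbrs y∈ e) ; total = z≤n }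
      where open Frame F using (U⊆S; A⊆S; v∈S)

    -- Removing `xs` costs 3l for its length l. The kept vertices return 2l + (l mod 3) and the lost
    -- edges return `w`, so the profit is (l mod 3) + w - l, of which `s` is recorded as slack.
    gain-peel : ∀ {v A U g w} s xs → Frame v A U → (Γ : Gain v A U g) → (∀ {z} → z ∈ xs → z ∈ˢ U) →
      Peel (Gain.R Γ) (_≡ v) xs w → length xs + s ≤ length xs % 3 + w → Gain v A (U ∖ xs) (g + s)
    gain-peel {v} {A} {U} {g} {w} s xs F Γ xs⊆U pl num = record
      { R = R ∖ xs ; R⊆S = R⊆S ∘ old ; U⊆R = λ x∈ → let x∈U , x∉ = ∖⁻ U xs x∈ in ∖⁺ R xs (U⊆R x∈U) x∉
      ; A⊆R = λ a∈ → ∖⁺ R xs (A⊆R a∈) (A∩U a∈ ∘ xs⊆U) ; v∈R = ∖⁺ R xs v∈R v∉xs ; closed = closed′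
      ; Y = keep xs ++ Y
      ; Y-unique = Unique.++⁺ (keep-unique (peel-unique pl)) Y-unique
          λ (y∈ , y∈Y) → proj₂ (Y-out y∈Y) (peel-⊆ pl (keep-⊆ xs y∈))
      ; Y-out = λ y∈ → [ (λ y∈k → R⊆S (peel-⊆ pl (keep-⊆ xs y∈k)) , λ y∈R → proj₂ (∖⁻ R xs y∈R) (keep-⊆ xs y∈k))
                       , (λ y∈Y → proj₁ (Y-out y∈Y) , proj₂ (Y-out y∈Y) ∘ old) ]′ (∈-++⁻ (keep xs) y∈)
      ; Y-diss = Diss-⊆ (∈-++⁻ (keep xs)) (Diss-⊎ (keep-diss pl λ { x∈ refl → v∉xs x∈ }) Y-diss
          -- Vertices removed earlier are adjacent only to `v` within `R`, and `v` is not in `xs`.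
          λ { x∈ y∈ e → v∉xs (subst (_∈ xs)
              (closed (proj₁ (Y-out y∈)) (proj₂ (Y-out y∈)) (peel-⊆ pl (keep-⊆ xs x∈)) (~-sym e)) (keep-⊆ xs x∈)) })
      ; slack = slack + s
      ; bound = arith (3 * ∣ S ∣) slack s (E R) ∣ R ∣ (length Y) (E S) (length xs) (∣ R ∖ xs ∣) (E (R ∖ xs)) w
                  (length (keep xs)) (length xs % 3) bound (∣∖∣ R xs) (peel-E pl) num (keep-length xs)
                  (length (keep xs ++ Y)) (length-++ (keep xs))
      ; heads = heads ; heads-unique = heads-unique ; heads-adj = heads-adj ; heads∉A = heads∉A
      ; heads-conn = λ h∈ → let a , a∈ , c = heads-conn h∈ in a , a∈ ,
          Conn-mono (λ (x∈R , x∉U , x≢v) → ∖⁺ R xs x∈R (x∉U ∘ xs⊆U) , x∉U ∘ proj₁ ∘ ∖⁻ U xs , x≢v) c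
      ; v-nbrs = v-nbrs′
      ; total = total′ }
      where
      open Gain Γ
      open Frame F using (A∩U; v∉U)
      old : ∀ {x} → x ∈ˢ R ∖ xs → x ∈ˢ R
      old x∈ = proj₁ (∖⁻ R xs x∈)
      v∉xs : v ∉ xs
      v∉xs v∈ = v∉U (xs⊆U v∈)
      closed′ : ∀ {x y} → x ∈ˢ S → ¬ x ∈ˢ R ∖ xs → y ∈ˢ R ∖ xs → x ~ y → y ≡ v
      closed′ {x} x∈ x∉ y∈ e with T? (R x) | x ∈? xs
      ... | no x∉R | _ = closed x∈ x∉R (old y∈) e
      ... | yes x∈R | yes x∈xs = peel-closed pl x∈xs (old y∈) (proj₂ (∖⁻ R xs y∈)) e
      ... | yes x∈R | no x∉xs = contradiction (∖⁺ R xs x∈R x∉xs) x∉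
      v-nbrs′ : ∀ {y} → y ∈ˢ R ∖ xs → v ~ y → y ∈ A ⊎ y ∈ˢ U ∖ xs ⊎ y ∈ heads
      v-nbrs′ y∈ e with v-nbrs (old y∈) e
      ... | inj₁ y∈A = inj₁ y∈A
      ... | inj₂ (inj₁ y∈U) = inj₂ (inj₁ (∖⁺ U xs y∈U (proj₂ (∖⁻ R xs y∈))))
      ... | inj₂ (inj₂ y∈h) = inj₂ (inj₂ y∈h)
      total′ : g + s ≤ slack + s + length heads
      total′ = begin
        g + s                      ≤⟨ ℕ.+-monoˡ-≤ s total ⟩
        slack + length heads + s   ≡⟨ shuffle slack (length heads) s ⟩
        slack + s + length heads   ∎
        where
        open ≤-Reasoning
        shuffle : ∀ a b c → a + b + c ≡ a + c + b
        shuffle = solve-∀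
      arith : ∀ σ sl s e r y eS l r′ e′ w k m → σ + (sl + e) ≤ 3 * r + (3 * y + eS) → r ≤ l + r′ → e′ + w ≤ e →
        l + s ≤ m + w → 3 * k ≡ 2 * l + m → ∀ ky → ky ≡ k + y → σ + (sl + s + e′) ≤ 3 * r′ + (3 * ky + eS)
      arith σ sl s e r y eS l r′ e′ w k m p₁ p₂ p₃ p₄ p₅ _ refl = ℕ.+-cancelʳ-≤ (l + w) _ _ (begin
        σ + (sl + s + e′) + (l + w)               ≡⟨ shuffle₁ σ sl s e′ l w ⟩
        (l + s) + (σ + (sl + (e′ + w)))           ≤⟨ ℕ.+-mono-≤ p₄ (ℕ.+-monoʳ-≤ σ (ℕ.+-monoʳ-≤ sl p₃)) ⟩
        (m + w) + (σ + (sl + e))                  ≤⟨ ℕ.+-monoʳ-≤ (m + w) p₁ ⟩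
        (m + w) + (3 * r + (3 * y + eS))
          ≤⟨ ℕ.+-monoʳ-≤ (m + w) (ℕ.+-monoˡ-≤ (3 * y + eS) (ℕ.*-monoʳ-≤ 3 p₂)) ⟩
        (m + w) + (3 * (l + r′) + (3 * y + eS))   ≡⟨ shuffle₂ m w l r′ y eS ⟩
        (2 * l + m) + (3 * r′ + (3 * y + eS)) + (l + w)  ≡⟨ cong (λ t → t + (3 * r′ + (3 * y + eS)) + (l + w)) p₅ ⟨
        3 * k + (3 * r′ + (3 * y + eS)) + (l + w)        ≡⟨ shuffle₃ k r′ y eS (l + w) ⟩
        3 * r′ + (3 * (k + y) + eS) + (l + w)            ∎)
        where
        open ≤-Reasoning
        shuffle₁ : ∀ σ sl s e′ l w → σ + (sl + s + e′) + (l + w) ≡ (l + s) + (σ + (sl + (e′ + w)))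
        shuffle₁ = solve-∀
        shuffle₂ : ∀ m w l r′ y eS → (m + w) + (3 * (l + r′) + (3 * y + eS)) ≡
          (2 * l + m) + (3 * r′ + (3 * y + eS)) + (l + w)
        shuffle₂ = solve-∀
        shuffle₃ : ∀ k r′ y eS q → 3 * k + (3 * r′ + (3 * y + eS)) + q ≡ 3 * r′ + (3 * (k + y) + eS) + q
        shuffle₃ = solve-∀

    chain-conn : ∀ {P : Fin n → Set} {p x xs a} → Chain S p (x ∷ xs) a → (∀ {z} → z ∈ x ∷ xs → P z) → P a → Conn P x a
    chain-conn {xs = []} (b ∷ _) f pa = f (here refl) ∷⟨ succ b ⟩ ∎ pa
    chain-conn {xs = _ ∷ _} (b ∷ c) f pa = f (here refl) ∷⟨ succ b ⟩ chain-conn c (f ∘ there) pa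

    -- A later chain vertex has both its neighbours in the chain or equal to `a`, hence different
    -- from `v`. So an arc to a proper ancestor meets `v` only at its first vertex.
    chain-adjacent : ∀ {v x xs a} → v ∈ˢ S → v ∉ x ∷ xs → a ≢ v → Chain S v (x ∷ xs) a →
      ∀ {y} → y ∈ x ∷ xs → v ~ y → y ≡ x
    chain-adjacent v∈S v∉ a≢v _ (here eq) _ = eq
    chain-adjacent v∈S v∉ a≢v (_ ∷ c) (there y∈) e with chain-between c y∈
    ... | q , r , b , q∈ , r∈ with only b v∈S (~-sym e)
    ... | inj₁ refl = contradiction q∈ v∉
    chain-adjacent v∈S v∉ a≢v (_ ∷ c) (there y∈) e | q , r , b , q∈ , inj₁ r∈ | inj₂ refl =
      contradiction (there r∈) v∉
    chain-adjacent v∈S v∉ a≢v (_ ∷ c) (there y∈) e | q , r , b , q∈ , inj₂ r≡a | inj₂ refl =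
      contradiction (≡.sym r≡a) a≢v

    -- The arc stays in `R`, attached to the stack through `a`. Its unit of gain is the edge from
    -- `v` to its first vertex, which is lost only when `v` is deleted and is therefore recorded as
    -- a head.
    gain-arc : ∀ {v A U g x xs a} → Frame v A U → Gain v A U g → (∀ {z} → z ∈ x ∷ xs → z ∈ˢ U) →
      Chain S v (x ∷ xs) a → a ∈ A → Gain v A (U ∖ (x ∷ xs)) (g + 1)
    gain-arc {v} {A} {U} {g} {x} {xs} {a} F Γ xs⊆U ch@(b ∷ _) a∈ = record
      { R = R ; R⊆S = R⊆S ; U⊆R = U⊆R ∘ old ; A⊆R = A⊆R ; v∈R = v∈R ; closed = closed
      ; Y = Y ; Y-unique = Y-unique ; Y-out = Y-out ; Y-diss = Y-diss ; slack = slack ; bound = bound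
      ; heads = x ∷ heads
      ; heads-unique = All.tabulate (λ { h∈ refl → heads∉U h∈ (xs⊆U (here refl)) }) ∷ heads-unique
      ; heads-adj = λ { (here refl) → ~-sym (prev b) ; (there h∈) → heads-adj h∈ }
      ; heads∉A = λ { (here refl) x∈A → A∩U x∈A (xs⊆U (here refl)) ; (there h∈) → heads∉A h∈ }
      ; heads-conn = λ where
          (here refl) → a , a∈ , chain-conn ch
            (λ z∈ → U⊆R (xs⊆U z∈) , (λ z∈U → proj₂ (∖⁻ U (x ∷ xs) z∈U) z∈) , λ { refl → v∉U (xs⊆U z∈) })
            (A⊆R a∈ , A∩U a∈ ∘ old , λ { refl → v∉A a∈ })
          (there h∈) → let a′ , a′∈ , c = heads-conn h∈ in a′ , a′∈ ,
            Conn-mono (λ (z∈R , z∉U , z≢v) → z∈R , z∉U ∘ old , z≢v) c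
      ; v-nbrs = v-nbrs′
      ; total = subst (_≤ slack + suc (length heads)) (ℕ.+-comm 1 g)
          (≤-trans (s≤s total) (ℕ.≤-reflexive (≡.sym (ℕ.+-suc slack (length heads))))) }
      where
      open Gain Γ
      open Frame F using (A∩U; v∉U; v∉A; v∈S)
      old : ∀ {z} → z ∈ˢ U ∖ (x ∷ xs) → z ∈ˢ U
      old z∈ = proj₁ (∖⁻ U (x ∷ xs) z∈)
      heads∉U : ∀ {h} → h ∈ heads → ¬ h ∈ˢ U
      heads∉U h∈ = let _ , _ , c = heads-conn h∈ in proj₁ (proj₂ (Conn-source c))
      v-nbrs′ : ∀ {y} → y ∈ˢ R → v ~ y → y ∈ A ⊎ y ∈ˢ U ∖ (x ∷ xs) ⊎ y ∈ x ∷ heads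
      v-nbrs′ {y} y∈ e with v-nbrs y∈ e
      ... | inj₁ y∈A = inj₁ y∈A
      ... | inj₂ (inj₂ y∈h) = inj₂ (inj₂ (there y∈h))
      ... | inj₂ (inj₁ y∈U) with y ∈? (x ∷ xs)
      ... | no y∉ = inj₂ (inj₁ (∖⁺ U (x ∷ xs) y∈U y∉))
      ... | yes y∈xs = inj₂ (inj₂ (here (chain-adjacent v∈S (v∉U ∘ xs⊆U) (λ { refl → v∉A a∈ }) ch y∈xs e)))

    -- With the predecessor already gone, each vertex still has exactly the edge to its successor,
    -- the last one the edge to `v`: one lost edge per vertex.
    open-peel : ∀ {R v p} xs → R ⊆ˢ S → Chain S p xs v → ¬ p ∈ˢ R → v ∈ˢ R → v ∉ xs → Unique xs →
      (∀ {z} → z ∈ xs → z ∈ˢ R) → Peel R (_≡ v) xs (length xs)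
    open-peel [] R⊆S [] _ _ _ _ _ = []
    open-peel {R} {v} {p} (x ∷ xs) R⊆S (b ∷ c) p∉ v∈ v∉ (x∉ ∷ u) xs⊆R =
      peel (next xs v ∷ []) (xs⊆R (here refl)) ([] ∷ []) (λ { (here refl) → next∈ xs (xs⊆R ∘ there) , succ b })
        (λ y∈ e → [ (λ { refl → contradiction y∈ p∉ }) , next-case xs ]′ (only b (R⊆S y∈) e))
        (open-peel xs (R⊆S ∘ proj₁ ∘ del⁻ R) c (λ x∈ → proj₂ (del⁻ R x∈) refl) (del⁺ R v∈ (v∉ ∘ here)) (v∉ ∘ there) u
          (λ z∈ → del⁺ R (xs⊆R (there z∈)) λ { refl → All.lookup x∉ z∈ refl }))
      where
      next∈ : ∀ ys → (∀ {z} → z ∈ ys → z ∈ˢ R) → next ys v ∈ˢ R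
      next∈ [] _ = v∈
      next∈ (y ∷ _) f = f (here refl)
      next-case : ∀ ys {y} → y ≡ next ys v → y ≡ v ⊎ y ∈ take 1 ys
      next-case [] eq = inj₁ eq
      next-case (_ ∷ _) eq = inj₂ (here eq)

    -- The first vertex also loses its edge to `v`, so the count is one more than the number of
    -- vertices: all edges of the cycle.
    closed-peel : ∀ {R v x xs} → R ⊆ˢ S → Chain S v (x ∷ xs) v → v ∈ˢ R → v ∉ x ∷ xs → Unique (x ∷ xs) →
      (∀ {z} → z ∈ x ∷ xs → z ∈ˢ R) → Peel R (_≡ v) (x ∷ xs) (2 + length xs)
    closed-peel {xs = []} _ (b ∷ _) _ _ _ _ = contradiction refl (distinct b)
    closed-peel {R} {v} {x} {x′ ∷ xs} R⊆S (b ∷ c) v∈ v∉ (x∉ ∷ u) xs⊆R =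
      peel (v ∷ x′ ∷ []) (xs⊆R (here refl)) ((distinct b ∷ []) ∷ [] ∷ [])
        (λ { (here refl) → v∈ , prev b ; (there (here refl)) → xs⊆R (there (here refl)) , succ b })
        (λ y∈ e → [ inj₁ , inj₂ ∘ here ]′ (only b (R⊆S y∈) e))
        (open-peel (x′ ∷ xs) (R⊆S ∘ proj₁ ∘ del⁻ R) c (λ x∈ → proj₂ (del⁻ R x∈) refl)
          (del⁺ R v∈ (v∉ ∘ here)) (v∉ ∘ there) u
          (λ z∈ → del⁺ R (xs⊆R (there z∈)) λ { refl → All.lookup x∉ z∈ refl }))

    -- The profit (l mod 3) + w - l of removing the piece: 1 + 1 - 1 for `one`, 2 + 2 - 2 for `two`,
    -- and (l mod 3) + (l + 1) - l for an arc closing at `v`. An arc to a proper ancestor yields its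
    -- one edge to `v`.
    value : ∀ {v A U} → Piece v A U → ℕ
    value (one _ _ _ _) = 1
    value (two _ _ _ _ _ _) = 2
    value (arc x xs _ _ _ _ (here _)) = 1 + length (x ∷ xs) % 3
    value (arc _ _ _ _ _ _ (there _)) = 1

    1≤value : ∀ {v A U} (π : Piece v A U) → 1 ≤ value π
    1≤value (one _ _ _ _) = s≤s z≤n
    1≤value (two _ _ _ _ _ _) = s≤s z≤n
    1≤value (arc _ _ _ _ _ _ (here _)) = s≤s z≤n
    1≤value (arc _ _ _ _ _ _ (there _)) = s≤s z≤n

    gain-piece : ∀ {v A U g} → Frame v A U → Gain v A U g → (π : Piece v A U) → Gain v A (U ∖ verts π) (g + value π)
    gain-piece {v} F Γ π@(one x x∈ x~v cl) = gain-peel 1 (x ∷ []) F Γ (verts⊆ π)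
      (peel (v ∷ []) (U⊆R x∈) ([] ∷ []) (λ { (here refl) → v∈R , x~v }) (λ y∈ e → inj₁ (cl (R⊆S y∈) e)) []) ≤-refl
      where open Gain Γ
    gain-piece {v} F Γ π@(two x y x∈ y∈ b cl) = gain-peel 2 (x ∷ y ∷ []) F Γ (verts⊆ π)
      (peel (v ∷ y ∷ []) (U⊆R x∈) ((distinct b ∷ []) ∷ [] ∷ [])
        (λ { (here refl) → v∈R , prev b ; (there (here refl)) → U⊆R y∈ , succ b })
        (λ z∈ e → [ inj₁ , inj₂ ∘ here ]′ (only b (R⊆S z∈) e))
        -- Once `x` is gone, `y` is isolated and loses no edge.
        (peel [] (del⁺ R (U⊆R y∈) (~-irrefl (succ b) ∘ ≡.sym)) [] (λ ())
          (λ z∈ e → let z∈R , z≢x = del⁻ R z∈ in contradiction (cl (R⊆S z∈R) e) z≢x) [])) ≤-refl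
      where open Gain Γ
    gain-piece {v} F Γ π@(arc x xs a sub u ch (here refl)) = gain-peel (1 + length (x ∷ xs) % 3) (x ∷ xs) F Γ sub
      (closed-peel R⊆S ch v∈R (v∉U ∘ sub) u (U⊆R ∘ sub))
      (ℕ.≤-reflexive (shuffle (length (x ∷ xs)) (length (x ∷ xs) % 3)))
      where
      open Gain Γ
      open Frame F using (v∉U)
      shuffle : ∀ l m → l + (1 + m) ≡ m + (1 + l)
      shuffle = solve-∀
    gain-piece F Γ (arc x xs a sub u ch (there a∈)) = gain-arc F Γ sub ch a∈

    gain-weaken : ∀ {v A U g h} → h ≤ g → Gain v A U g → Gain v A U h
    gain-weaken h≤g Γ = record { Gain Γ ; total = ≤-trans h≤g (Gain.total Γ) }

    -- Induction is applied to `R` without `v`. The weight 3 of `v` is paid by the gain `g` from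
    -- below, the upward edges `ups`, the `β` representatives saved and the `γ` cycles destroyed.
    close : ∀ {v A U g} ups β γ → Frame v A U → (Γ : Gain v A U g) → (∀ {y} → y ∈ˢ U → ¬ v ~ y) →
      Unique ups → (∀ {y} → y ∈ ups → y ∈ A × v ~ y) →
      (∀ {L} → Cover S L → ∃ λ L′ → Cover (del (Gain.R Γ) v) L′ × β + length L′ ≤ length L) →
      (∀ {S′} → S′ ⊆ˢ S → ¬ v ∈ˢ S′ → γ + c₁In S′ ≤ c₁In S) →
      3 ≤ g + length ups + β + γ → Good S
    close {v} {A} {U} {g} ups β γ F Γ idle ups-unique ups-nbr cover bonus three {L} cov with cover cov
    ... | L′ , cov′ , β-bound =
      extend {S} {S′} {L} {L′} Y (ih S′ (∣∣-strict {S = S′} {S} {v} S′⊆S v∈S v∉S′)) cov′ S′⊆S Y-unique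
      (λ y∈ → proj₁ (Y-out y∈) , proj₂ (Y-out y∈) ∘ proj₁ ∘ del⁻ R) Y-diss
      (λ y∈ t∈ e → let t∈R , t≢v = del⁻ R t∈ in t≢v (closed (proj₁ (Y-out y∈)) (proj₂ (Y-out y∈)) t∈R e))
      (arith (3 * ∣ S ∣) slack (E R) (∣ R ∣) (3 * length Y) (E S) (∣ S′ ∣) (E S′) (length ups) (length heads) g β γ
        (length L′) (length L) (c₁In S′) (c₁In S) bound (∣del∣ R v) edges-v total three β-bound
        (bonus {S′} S′⊆S v∉S′))
      where
      open Gain Γ
      open Frame F using (v∈S)
      S′ : VSet n
      S′ = del R v
      S′⊆S : S′ ⊆ˢ S
      S′⊆S = R⊆S ∘ proj₁ ∘ del⁻ R
      v∉S′ : ¬ v ∈ˢ S′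
      v∉S′ v∈ = proj₂ (del⁻ R v∈) refl
      -- Heads avoid the stack, so the upward neighbours and the heads are distinct neighbours of
      -- `v`.
      edges-v : E S′ + (length ups + length heads) ≤ E R
      edges-v = subst (λ l → E S′ + l ≤ E R) (length-++ ups)
        (E-del R v∈R (Unique.++⁺ ups-unique heads-unique λ (y∈ , y∈h) → heads∉A y∈h (proj₁ (ups-nbr y∈)))
          λ y∈ → [ (λ y∈u → A⊆R (proj₁ (ups-nbr y∈u)) , proj₂ (ups-nbr y∈u))
                 , (λ y∈h → let _ , _ , c = heads-conn y∈h in proj₁ (Conn-source c) , heads-adj y∈h) ]′ (∈-++⁻ ups y∈))
      arith : ∀ σ sl e r y eS r′ e′ u h g β γ l′ l c′ c → σ + (sl + e) ≤ 3 * r + (y + eS) → r ≤ 1 + r′ →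
        e′ + (u + h) ≤ e → g ≤ sl + h → 3 ≤ g + u + β + γ → β + l′ ≤ l → γ + c′ ≤ c →
        σ + (e′ + l′ + c′) ≤ 3 * r′ + (y + (eS + l + c))
      arith σ sl e r y eS r′ e′ u h g β γ l′ l c′ c p₁ p₂ p₃ p₄ p₅ p₆ p₇ = ℕ.+-cancelˡ-≤ 3 _ _ (begin
        3 + (σ + (e′ + l′ + c′))                               ≤⟨ ℕ.+-monoˡ-≤ (σ + (e′ + l′ + c′)) p₅ ⟩
        (g + u + β + γ) + (σ + (e′ + l′ + c′))                 ≡⟨ shuffle₁ g u β γ σ e′ l′ c′ ⟩
        g + (σ + (e′ + u) + ((β + l′) + (γ + c′)))
          ≤⟨ ℕ.+-mono-≤ p₄ (ℕ.+-monoʳ-≤ (σ + (e′ + u)) (ℕ.+-mono-≤ p₆ p₇)) ⟩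
        (sl + h) + (σ + (e′ + u) + (l + c))                    ≡⟨ shuffle₂ sl h σ e′ u (l + c) ⟩
        σ + (sl + (e′ + (u + h))) + (l + c)
          ≤⟨ ℕ.+-monoˡ-≤ (l + c) (ℕ.+-monoʳ-≤ σ (ℕ.+-monoʳ-≤ sl p₃)) ⟩
        σ + (sl + e) + (l + c)                                 ≤⟨ ℕ.+-monoˡ-≤ (l + c) p₁ ⟩
        3 * r + (y + eS) + (l + c)
          ≤⟨ ℕ.+-monoˡ-≤ (l + c) (ℕ.+-monoˡ-≤ (y + eS) (ℕ.*-monoʳ-≤ 3 p₂)) ⟩
        3 * (1 + r′) + (y + eS) + (l + c)                      ≡⟨ shuffle₃ r′ y eS l c ⟩
        3 + (3 * r′ + (y + (eS + l + c)))                      ∎)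
        where
        open ≤-Reasoning
        shuffle₁ : ∀ g u β γ σ e′ l′ c′ →
          (g + u + β + γ) + (σ + (e′ + l′ + c′)) ≡ g + (σ + (e′ + u) + ((β + l′) + (γ + c′)))
        shuffle₁ = solve-∀
        shuffle₂ : ∀ sl h σ e′ u q → (sl + h) + (σ + (e′ + u) + q) ≡ σ + (sl + (e′ + (u + h))) + q
        shuffle₂ = solve-∀
        shuffle₃ : ∀ r′ y eS l c → 3 * (1 + r′) + (y + eS) + (l + c) ≡ 3 + (3 * r′ + (y + (eS + l + c)))
        shuffle₃ = solve-∀

    Bonus : Fin n → ℕ → Set
    Bonus v γ = ∀ {S′} → S′ ⊆ˢ S → ¬ v ∈ˢ S′ → γ + c₁In S′ ≤ c₁In S

    no-bonus : ∀ {v} → Bonus v 0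
    no-bonus {S′ = S′} sub _ = c₁In-mono {S′} {S} sub

    -- No component is created: each surviving neighbour of `v` is on the stack or is a head joined
    -- to it by an arc, and the stack without `v` is still a path ending at `p`, which serves as the
    -- hub.
    close-inner : ∀ {v p A U g} ups γ → Frame v (p ∷ A) U → Gain v (p ∷ A) U g → (∀ {y} → y ∈ˢ U → ¬ v ~ y) →
      Unique ups → (∀ {y} → y ∈ ups → y ∈ p ∷ A × v ~ y) → Bonus v γ → 3 ≤ g + length ups + 0 + γ → Good S
    close-inner {v} {p} {A} {U} ups γ F Γ idle ups-unique ups-nbr bonus three =
      close ups 0 γ F Γ idle ups-unique ups-nbr
        (λ {L} cov → map (redirect S′ p) L
                   , cover-redirect {S} {S′} {p} {L} (R⊆S ∘ proj₁ ∘ del⁻ R) (A⊆S′ (here refl)) hub cov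
                   , ℕ.≤-reflexive (length-map (redirect S′ p) L))
        bonus three
      where
      open Gain Γ
      open Frame F using (v∉A; linked)
      S′ : VSet n
      S′ = del R v
      A⊆S′ : ∀ {a} → a ∈ p ∷ A → a ∈ˢ S′
      A⊆S′ a∈ = del⁺ R (A⊆R a∈) λ { refl → v∉A a∈ }
      stack : ∀ {a} → a ∈ p ∷ A → Conn (_∈ˢ S′) a p
      stack = linked-conn (Linked.tail linked) A⊆S′
      hub : ∀ {x y} → x ∈ˢ S → ¬ x ∈ˢ S′ → y ∈ˢ S′ → x ~ y → Conn (_∈ˢ S′) y p
      hub {x} {y} x∈ x∉ y∈ e with del⁻ R y∈ | T? (R x)
      ... | y∈R , y≢v | no x∉R = contradiction (closed x∈ x∉R y∈R e) y≢v
      ... | y∈R , _ | yes x∈R with del-split R {v} x∈R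
      ... | inj₂ x∈S′ = contradiction x∈S′ x∉
      ... | inj₁ refl with v-nbrs y∈R e
      ... | inj₁ y∈A = stack y∈A
      ... | inj₂ (inj₁ y∈U) = contradiction e (idle y∈U)
      ... | inj₂ (inj₂ y∈h) with heads-conn y∈h
      ... | a , a∈ , c = Conn-trans (Conn-mono (λ (z∈R , _ , z≢v) → del⁺ R z∈R z≢v) c) (stack a∈)

    -- A head would have to reach the empty stack, so `v` keeps no neighbour in `R`. What is removed
    -- is thus separated from the rest, and one representative is saved.
    close-root : ∀ {v U g} γ → Frame v [] U → Gain v [] U g → (∀ {y} → y ∈ˢ U → ¬ v ~ y) →
      Bonus v γ → 3 ≤ g + 0 + 1 + γ → Good S
    close-root {v} {U} γ F Γ idle bonus three =
      close [] 1 γ F Γ idle [] (λ ())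
        (λ cov → cover-component {S} {S′} {v} v∈S (λ v∈ → proj₂ (del⁻ R v∈) refl) (R⊆S ∘ proj₁ ∘ del⁻ R) sep cov)
        bonus three
      where
      open Gain Γ
      open Frame F using (v∈S)
      S′ : VSet n
      S′ = del R v
      sep : ∀ {x y} → x ∈ˢ S → ¬ x ∈ˢ S′ → y ∈ˢ S′ → ¬ x ~ y
      sep {x} {y} x∈ x∉ y∈ e with del⁻ R y∈ | T? (R x)
      ... | y∈R , y≢v | no x∉R = y≢v (closed x∈ x∉R y∈R e)
      ... | y∈R , _ | yes x∈R with del-split R {v} x∈R
      ... | inj₂ x∈S′ = x∉ x∈S′
      ... | inj₁ refl with v-nbrs y∈R e
      ... | inj₂ (inj₁ y∈U) = idle y∈U e
      ... | inj₂ (inj₂ y∈h) with heads-conn y∈h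
      ... | a , () , c

    -- For components that are too small for a deletion to be paid for at the root: `xs` is peeled
    -- with no edge leaving, `keep` takes its share, and the component itself contributes the final
    -- 1.
    keep-component : ∀ {v xs w} → Peel S (λ _ → ⊥) (v ∷ xs) w →
      length (v ∷ xs) ≤ length (v ∷ xs) % 3 + w + 1 → Good S
    keep-component {v} {xs} {w} pl num {L} cov
      with cover-component {S} {S ∖ (v ∷ xs)} {v} (peel-⊆ pl (here refl)) (λ v∈ → proj₂ (∖⁻ S (v ∷ xs) v∈) (here refl))
             (proj₁ ∘ ∖⁻ S (v ∷ xs)) sep cov
      where
      sep : ∀ {x y} → x ∈ˢ S → ¬ x ∈ˢ S ∖ (v ∷ xs) → y ∈ˢ S ∖ (v ∷ xs) → ¬ x ~ y
      sep {x} x∈ x∉ y∈ e with x ∈? (v ∷ xs)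
      ... | no x∉xs = x∉ (∖⁺ S (v ∷ xs) x∈ x∉xs)
      ... | yes x∈xs = let y∈S , y∉xs = ∖⁻ S (v ∷ xs) y∈ in peel-closed pl x∈xs y∈S y∉xs e
    ... | L′ , cov′ , L′<L = extend {S} {S′} {L} {L′} (keep (v ∷ xs))
      (ih S′ (∣∣-strict {S = S′} {S} {v} S′⊆S (peel-⊆ pl (here refl)) (λ v∈ → proj₂ (∖⁻ S (v ∷ xs) v∈) (here refl))))
      cov′ S′⊆S (keep-unique (peel-unique pl))
      (λ y∈ → peel-⊆ pl (keep-⊆ (v ∷ xs) y∈) , λ y∈S′ → proj₂ (∖⁻ S (v ∷ xs) y∈S′) (keep-⊆ (v ∷ xs) y∈))
      (keep-diss pl (λ _ ()))
      (λ y∈ t∈ e → let t∈S , t∉xs = ∖⁻ S (v ∷ xs) t∈ in peel-closed pl (keep-⊆ (v ∷ xs) y∈) t∈S t∉xs e)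
      (arith (∣ S ∣) (∣ S′ ∣) (length (v ∷ xs)) (length (v ∷ xs) % 3) w (length (keep (v ∷ xs))) (E S′) (E S)
        (length L′) (length L) (c₁In S′) (c₁In S)
        (∣∖∣ S (v ∷ xs)) num (keep-length (v ∷ xs)) (peel-E pl) L′<L (c₁In-mono {S′} {S} S′⊆S))
      where
      S′ : VSet n
      S′ = S ∖ (v ∷ xs)
      S′⊆S : S′ ⊆ˢ S
      S′⊆S = proj₁ ∘ ∖⁻ S (v ∷ xs)
      arith : ∀ s s′ l m w k e′ e l′ L c′ c → s ≤ l + s′ → l ≤ m + w + 1 → 3 * k ≡ 2 * l + m → e′ + w ≤ e →
        1 + l′ ≤ L → c′ ≤ c → 3 * s + (e′ + l′ + c′) ≤ 3 * s′ + (3 * k + (e + L + c))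
      arith s s′ l m w k e′ e l′ L c′ c p₁ p₂ p₃ p₄ p₅ p₆ = begin
        3 * s + (e′ + l′ + c′)                                 ≤⟨ ℕ.+-monoˡ-≤ (e′ + l′ + c′) (ℕ.*-monoʳ-≤ 3 p₁) ⟩
        3 * (l + s′) + (e′ + l′ + c′)                          ≡⟨ shuffle₁ l s′ e′ l′ c′ ⟩
        l + (3 * s′ + (2 * l + (e′ + l′ + c′)))                ≤⟨ ℕ.+-monoˡ-≤ (3 * s′ + (2 * l + (e′ + l′ + c′))) p₂ ⟩
        m + w + 1 + (3 * s′ + (2 * l + (e′ + l′ + c′)))        ≡⟨ shuffle₂ m w s′ l e′ l′ c′ ⟩
        3 * s′ + ((2 * l + m) + ((e′ + w) + (1 + l′) + c′))
          ≤⟨ ℕ.+-monoʳ-≤ (3 * s′) (ℕ.+-mono-≤ (ℕ.≤-reflexive (≡.sym p₃)) (ℕ.+-mono-≤ (ℕ.+-mono-≤ p₄ p₅) p₆)) ⟩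
        3 * s′ + (3 * k + (e + L + c))                         ∎
        where
        open ≤-Reasoning
        shuffle₁ : ∀ l s′ e′ l′ c′ → 3 * (l + s′) + (e′ + l′ + c′) ≡ l + (3 * s′ + (2 * l + (e′ + l′ + c′)))
        shuffle₁ = solve-∀
        shuffle₂ : ∀ m w s′ l e′ l′ c′ → m + w + 1 + (3 * s′ + (2 * l + (e′ + l′ + c′))) ≡
          3 * s′ + ((2 * l + m) + ((e′ + w) + (1 + l′) + c′))
        shuffle₂ = solve-∀

    -- The exact shape below `v` matters only while `v` may still become part of a new piece, that
    -- is, with at most one piece below it. Two pieces are worth at least 2, and the upward edge or
    -- the root supplies the third unit.
    data State (v : Fin n) (A : List (Fin n)) (U₀ : VSet n) : VSet n → Set where
      none   : State v A U₀ U₀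
      single : (π : Piece v A U₀) → State v A U₀ (U₀ ∖ verts π)
      many   : ∀ {U} → Gain v A U 2 → State v A U₀ U

    advance : ∀ {v A U₀ U} → Frame v A U₀ → (∀ {y} → y ∈ˢ S → v ~ y → y ∈ A ⊎ y ∈ˢ U₀) →
      Frame v A U → State v A U₀ U → (π : Piece v A U) → State v A U₀ (U ∖ verts π)
    advance F₀ nbrs F none π = single π
    advance F₀ nbrs F (single π₀) π = many (gain-weaken (ℕ.+-mono-≤ (1≤value π₀) (1≤value π))
      (gain-piece F (gain-piece F₀ (gain₀ F₀ nbrs) π₀) π))
    advance F₀ nbrs F (many Γ) π = many (gain-weaken (ℕ.m≤m+n 2 (value π)) (gain-piece F Γ π))

    another : ∀ v A (xs : List (Fin n)) → (∃ λ a → a ∈ A × v ~ a × a ∉ xs) ⊎ (∀ {a} → a ∈ A → v ~ a → a ∈ xs)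
    another v A xs with any? (λ a → (a ∈? A) ×-dec T? (adj G v a) ×-dec ¬? (a ∈? xs))
    ... | yes (a , a∈ , e , a∉) = inj₁ (a , a∈ , e , a∉)
    ... | no ¬ex = inj₂ λ {a} a∈ e → decidable-stable (a ∈? xs) λ a∉ → ¬ex (a , a∈ , e , a∉)

    idle-nbrs : ∀ {v A U₀ xs} → (∀ {y} → y ∈ˢ S → v ~ y → y ∈ A ⊎ y ∈ˢ U₀) → (∀ {y} → y ∈ˢ U₀ ∖ xs → ¬ v ~ y) →
      ∀ {y} → y ∈ˢ S → v ~ y → y ∈ A ⊎ y ∈ xs
    idle-nbrs {U₀ = U₀} {xs} nbrs idle {y} y∈ e with nbrs y∈ e
    ... | inj₁ y∈A = inj₁ y∈A
    ... | inj₂ y∈U with y ∈? xs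
    ... | yes y∈xs = inj₂ y∈xs
    ... | no y∉ = contradiction e (idle (∖⁺ U₀ xs y∈U y∉))

    -- If the arc length is 0 modulo 3, the cycle length is 1 modulo 3 and a destroyed cycle adds a
    -- unit; otherwise the remainder is at least 1. Either way a closing arc is worth 2.
    cycle-value : ∀ {v A U x xs} → Frame v A U → Chain S v (x ∷ xs) v → Unique (x ∷ xs) →
      (∀ {z} → z ∈ x ∷ xs → z ∈ˢ U) → ∃ λ γ → Bonus v γ × 2 ≤ 1 + length (x ∷ xs) % 3 + γ
    cycle-value {v} {x = x} {xs} F ch u sub with length (x ∷ xs) % 3 in eq
    ... | zero = 1 , (λ {S′} S′⊆ v∉ → closedChain-c₁ {S} {S′} ch (All.tabulate (λ { z∈ refl → v∉U (sub z∈) }) ∷ u)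
                        (λ { (here refl) → v∈S ; (there z∈) → U⊆S (sub z∈) }) eq S′⊆ v∉) , ≤-refl
      where open Frame F
    ... | suc m = 0 , (λ {S′} → no-bonus {v} {S′}) , s≤s (s≤s z≤n)

    -- The values fall short of 3 in four cases: nothing lies below `v` and it has one or two upward
    -- edges, giving a pendant vertex or a one-vertex arc; or a pendant vertex or an arc to an
    -- ancestor lies below and `p` is the only upward neighbour, so that `v` prolongs it.
    finish : ∀ {v p A U₀ U W} → Frame v (p ∷ A) U₀ → (∀ {y} → y ∈ˢ S → v ~ y → y ∈ p ∷ A ⊎ y ∈ˢ U₀) →
      Frame v (p ∷ A) U → State v (p ∷ A) U₀ U → (∀ {y} → y ∈ˢ U → ¬ v ~ y) → v ∈ˢ W → U₀ ⊆ˢ W →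
      Good S ⊎ Piece p A W
    finish {v} {p} {A} {U₀} {_} {W} F₀ nbrs F st idle v∈W U₀⊆W = go st idle F
      where
      open Frame F₀
      v~p : v ~ p
      v~p = Linked.head linked
      p-nbr : ∀ {y} → y ∈ p ∷ [] → y ∈ p ∷ A × v ~ y
      p-nbr (here refl) = here refl , v~p
      two-nbrs : ∀ {a} → a ∈ p ∷ A → v ~ a → ∀ {y} → y ∈ p ∷ a ∷ [] → y ∈ p ∷ A × v ~ y
      two-nbrs a∈ e (here refl) = here refl , v~p
      two-nbrs a∈ e (there (here refl)) = a∈ , e
      pair-unique : ∀ {a} → a ∉ p ∷ [] → Unique (p ∷ a ∷ [])
      pair-unique a∉ = ((λ { refl → a∉ (here refl) }) ∷ []) ∷ [] ∷ []
      Γ₀ : Gain v (p ∷ A) U₀ 0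
      Γ₀ = gain₀ F₀ nbrs
      go : ∀ {U} → State v (p ∷ A) U₀ U → (∀ {y} → y ∈ˢ U → ¬ v ~ y) → Frame v (p ∷ A) U → Good S ⊎ Piece p A W
      go (many Γ) idle F = inj₁ (close-inner (p ∷ []) 0 F Γ idle ([] ∷ []) p-nbr (λ {S′} → no-bonus {v} {S′}) ≤-refl)
      go none idle _ with another v (p ∷ A) (p ∷ [])
      ... | inj₂ only-p = inj₂ (one v v∈W v~p λ y∈ e →
              [ (λ y∈A → single⁻ (only-p y∈A e)) , (λ y∈U → contradiction e (idle y∈U)) ]′ (nbrs y∈ e))
        where
        single⁻ : ∀ {y} → y ∈ p ∷ [] → y ≡ p
        single⁻ (here eq) = eq
      ... | inj₁ (a , a∈ , v~a , a∉) with another v (p ∷ A) (p ∷ a ∷ [])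
      -- Three upward edges pay for `v` with nothing below.
      ... | inj₁ (b , b∈ , v~b , b∉) = inj₁ (close-inner (b ∷ p ∷ a ∷ []) 0 F₀ Γ₀ idle
              (All.tabulate (λ { z∈ refl → b∉ z∈ }) ∷ pair-unique a∉)
              (λ { (here refl) → b∈ , v~b ; (there z∈) → two-nbrs a∈ v~a z∈ }) (λ {S′} → no-bonus {v} {S′}) ≤-refl)
      ... | inj₂ only-pa = inj₂ (arc v [] a (λ { (here refl) → v∈W }) ([] ∷ [])
              (between v~p v~a (λ { refl → a∉ (here refl) })
                (λ y∈ e → [ (λ y∈A → pair⁻ (only-pa y∈A e))
                          , (λ y∈U → contradiction e (idle y∈U)) ]′ (nbrs y∈ e)) ∷ []) a∈)
        where
        pair⁻ : ∀ {y} → y ∈ p ∷ a ∷ [] → y ≡ p ⊎ y ≡ a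
        pair⁻ (here eq) = inj₁ eq
        pair⁻ (there (here eq)) = inj₂ eq
      go (single π@(two _ _ _ _ _ _)) idle F =
        inj₁ (close-inner (p ∷ []) 0 F (gain-piece F₀ Γ₀ π) idle ([] ∷ []) p-nbr (λ {S′} → no-bonus {v} {S′}) ≤-refl)
      go (single π@(arc x xs _ sub u ch (here refl))) idle F with cycle-value F₀ ch u sub
      ... | γ , bonus , two≤ =
        inj₁ (close-inner (p ∷ []) γ F (gain-piece F₀ Γ₀ π) idle ([] ∷ []) p-nbr (λ {S′} → bonus {S′})
          (subst (3 ≤_) (shuffle (length (x ∷ xs) % 3) γ) (s≤s two≤)))
        where
        shuffle : ∀ m γ → 1 + (1 + m + γ) ≡ 1 + m + 1 + 0 + γ
        shuffle = solve-∀
      go (single π@(one x x∈ x~v cl)) idle F with another v (p ∷ A) (p ∷ [])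
      -- The pendant vertex is worth 1 and the two upward edges 2.
      ... | inj₁ (a , a∈ , v~a , a∉) = inj₁ (close-inner (p ∷ a ∷ []) 0 F (gain-piece F₀ Γ₀ π) idle (pair-unique a∉)
              (two-nbrs a∈ v~a) (λ {S′} → no-bonus {v} {S′}) ≤-refl)
      ... | inj₂ only-p = inj₂ (two v x v∈W (U₀⊆W x∈)
              (between v~p (~-sym x~v) (λ { refl → A∩U (here refl) x∈ }) only-px) cl)
        where
        only-px : ∀ {y} → y ∈ˢ S → v ~ y → y ≡ p ⊎ y ≡ x
        only-px y∈ e with idle-nbrs {v} {p ∷ A} {U₀} {x ∷ []} nbrs idle y∈ e
        ... | inj₂ (here eq) = inj₂ eq
        ... | inj₁ y∈A with only-p y∈A e
        ... | here eq = inj₁ eq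
      go (single π@(arc x xs a sub u ch@(b ∷ _) (there a∈))) idle F with another v (p ∷ A) (p ∷ [])
      ... | inj₁ (c , c∈ , v~c , c∉) = inj₁ (close-inner (p ∷ c ∷ []) 0 F (gain-piece F₀ Γ₀ π) idle (pair-unique c∉)
              (two-nbrs c∈ v~c) (λ {S′} → no-bonus {v} {S′}) ≤-refl)
      ... | inj₂ only-p = inj₂ (arc v (x ∷ xs) a (λ { (here refl) → v∈W ; (there z∈) → U₀⊆W (sub z∈) })
              (All.tabulate (λ { z∈ refl → v∉U (sub z∈) }) ∷ u)
              (between v~p (~-sym (prev b)) (λ { refl → A∩U (here refl) (sub (here refl)) }) only-px ∷ ch) a∈)
        where
        only-px : ∀ {y} → y ∈ˢ S → v ~ y → y ≡ p ⊎ y ≡ x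
        only-px y∈ e with idle-nbrs {v} {p ∷ A} {U₀} {x ∷ xs} nbrs idle y∈ e
        ... | inj₂ y∈xs = inj₂ (chain-adjacent v∈S (v∉U ∘ sub) (λ { refl → v∉A a∈ }) ch y∈xs e)
        ... | inj₁ y∈A with only-p y∈A e
        ... | here eq = inj₁ eq

    -- With no ancestors, an arc can only close at `v`. A component with one or two vertices is kept
    -- whole; in all other cases the values reach 3 with the unit for the lost component.
    finish-root : ∀ {v U₀ U} → Frame v [] U₀ → (∀ {y} → y ∈ˢ S → v ~ y → y ∈ [] ⊎ y ∈ˢ U₀) →
      Frame v [] U → State v [] U₀ U → (∀ {y} → y ∈ˢ U → ¬ v ~ y) → Good S
    finish-root {v} F₀ nbrs F none idle = keep-component
      (peel [] (Frame.v∈S F) [] (λ ()) (λ y∈ e → contradiction e ([ (λ ()) , idle ]′ (nbrs y∈ e))) []) (s≤s z≤n)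
    finish-root {v} {U₀} F₀ nbrs F (single (one x x∈ x~v cl)) idle = keep-component
      (peel (x ∷ []) v∈S ([] ∷ []) (λ { (here refl) → U⊆S x∈ , ~-sym x~v })
        (λ y∈ e → [ (λ ()) , inj₂ ]′ (idle-nbrs {v} {[]} {U₀} {x ∷ []} nbrs idle y∈ e))
        (peel [] (del⁺ S (U⊆S x∈) (~-irrefl x~v)) [] (λ ())
          (λ y∈ e → let y∈S , y≢v = del⁻ S y∈ in contradiction (cl y∈S e) y≢v) [])) (s≤s (s≤s z≤n))
      where open Frame F₀
    finish-root {v} F₀ nbrs F (single π@(two _ _ _ _ _ _)) idle =
      close-root 0 F (gain-piece F₀ (gain₀ F₀ nbrs) π) idle (λ {S′} → no-bonus {v} {S′}) ≤-refl
    finish-root F₀ nbrs F (single π@(arc x xs _ sub u ch (here refl))) idle with cycle-value F₀ ch u sub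
    ... | γ , bonus , two≤ = close-root γ F (gain-piece F₀ (gain₀ F₀ nbrs) π) idle (λ {S′} → bonus {S′})
        (subst (3 ≤_) (shuffle (length (x ∷ xs) % 3) γ) (s≤s two≤))
      where
      shuffle : ∀ m γ → 1 + (1 + m + γ) ≡ 1 + m + 0 + 1 + γ
      shuffle = solve-∀
    finish-root {v} F₀ nbrs F (many Γ) idle = close-root 0 F Γ idle (λ {S′} → no-bonus {v} {S′}) ≤-refl

    -- Running the search

    child : ∀ {v A U u} → Frame v A U → u ∈ˢ U → v ~ u → Frame u (v ∷ A) (del U u)
    child {v} {A} {U} {u} F u∈ v~u = record
      { v∈S = U⊆S u∈ ; A⊆S = λ { (here refl) → v∈S ; (there a∈) → A⊆S a∈ } ; U⊆S = U⊆S ∘ proj₁ ∘ del⁻ U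
      ; v∉A = λ { (here refl) → v∉U u∈ ; (there u∈A) → A∩U u∈A u∈ } ; v∉U = λ u∈′ → proj₂ (del⁻ U u∈′) refl
      ; A∩U = λ { (here refl) v∈ → v∉U (proj₁ (del⁻ U v∈)) ; (there x∈) x∈U → A∩U x∈ (proj₁ (del⁻ U x∈U)) }
      ; linked = ~-sym v~u ∷ linked ; closed = λ x∈ → closed′ (proj₁ (del⁻ U x∈)) }
      where
      open Frame F
      closed′ : ∀ {x y} → x ∈ˢ U → y ∈ˢ S → x ~ y → y ∈ u ∷ v ∷ A ⊎ y ∈ˢ del U u
      closed′ x∈ y∈ e with closed x∈ y∈ e
      ... | inj₁ y∈A = inj₁ (there y∈A)
      ... | inj₂ y∈U = [ inj₁ ∘ here , inj₂ ]′ (del-split U y∈U)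

    child-nbrs : ∀ {v A U u} → Frame v A U → u ∈ˢ U → ∀ {y} → y ∈ˢ S → u ~ y → y ∈ v ∷ A ⊎ y ∈ˢ del U u
    child-nbrs {U = U} F u∈ y∈ e with Frame.closed F u∈ y∈ e
    ... | inj₁ y∈A = inj₁ y∈A
    ... | inj₂ y∈U = inj₂ (del⁺ U y∈U (~-irrefl e ∘ ≡.sym))

    verts-nonempty : ∀ {v A U} (π : Piece v A U) → ∃ λ x → x ∈ verts π
    verts-nonempty (one x _ _ _) = x , here refl
    verts-nonempty (two x _ _ _ _ _) = x , here refl
    verts-nonempty (arc x _ _ _ _ _ _) = x , here refl

    -- The bound `k` on the number of unvisited vertices justifies both recursive calls: entering
    -- `u` removes it from `U`, and returning to `v` with a nonempty piece removes that piece.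
    visit : ∀ k {v A U₀ U} → Frame v A U₀ → (∀ {y} → y ∈ˢ S → v ~ y → y ∈ A ⊎ y ∈ˢ U₀) →
      Frame v A U → State v A U₀ U → ∣ U ∣ < k →
      Good S ⊎ ∃ λ U → Frame v A U × State v A U₀ U × (∀ {y} → y ∈ˢ U → ¬ v ~ y)
    visit (suc k) {v} {A} {U₀} {U} F₀ nbrs F st (s≤s ∣U∣≤k) with any? (λ u → T? (U u) ×-dec T? (adj G v u))
    ... | no ¬ex = inj₂ (U , F , st , λ {y} y∈ e → ¬ex (y , y∈ , e))
    ... | yes (u , u∈ , v~u) with visit k (child F u∈ v~u) (child-nbrs F u∈) (child F u∈ v~u) none
              (≤-trans (∣∣-strict {S = del U u} {U} {u} (proj₁ ∘ del⁻ U) u∈ (λ u∈′ → proj₂ (del⁻ U u∈′) refl)) ∣U∣≤k)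
    ... | inj₁ good = inj₁ good
    ... | inj₂ (U′ , F′ , st′ , idle)
            -- The new piece contains `u` itself, so it lives in `U` rather than in the set left
            -- after entering `u`.
            with finish {W = U} (child F u∈ v~u) (child-nbrs F u∈) F′ st′ idle u∈ (proj₁ ∘ del⁻ U)
    ... | inj₁ good = inj₁ good
    ... | inj₂ π = visit k F₀ nbrs (shrink F π) (advance F₀ nbrs F st π)
            (≤-trans (∣∣-strict {S = U ∖ verts π} {U} {proj₁ (verts-nonempty π)} (proj₁ ∘ ∖⁻ U (verts π))
                (verts⊆ π (proj₂ (verts-nonempty π)))
                (λ x∈ → proj₂ (∖⁻ U (verts π) x∈) (proj₂ (verts-nonempty π)))) ∣U∣≤k)

    root-frame : ∀ {r} → r ∈ˢ S → Frame r [] (del S r)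
    root-frame {r} r∈ = record
      { v∈S = r∈ ; A⊆S = λ () ; U⊆S = proj₁ ∘ del⁻ S ; v∉A = λ () ; v∉U = λ r∈′ → proj₂ (del⁻ S r∈′) refl
      ; A∩U = λ () ; linked = [-] ; closed = λ _ y∈ _ → [ inj₁ ∘ here , inj₂ ]′ (del-split S y∈) }

    root-nbrs : ∀ {r y} → y ∈ˢ S → r ~ y → y ∈ [] ⊎ y ∈ˢ del S r
    root-nbrs y∈ e = inj₂ (del⁺ S y∈ (~-irrefl e ∘ ≡.sym))

    search : ∀ {r} → r ∈ˢ S → Good S
    search {r} r∈ with visit (suc ∣ del S r ∣) (root-frame r∈) root-nbrs (root-frame r∈) none ≤-refl
    ... | inj₁ good = good
    ... | inj₂ (_ , F , st , idle) = finish-root (root-frame r∈) root-nbrs F st idle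

  good : ∀ k S → ∣ S ∣ < k → Good S
  good (suc k) S (s≤s ∣S∣≤k) {L} cov with any? (T? ∘ S)
  ... | yes (r , r∈) = Search.search S (λ S′ lt → good k S′ (≤-trans lt ∣S∣≤k)) r∈ cov
  -- With `S` empty, `S` itself is a dissociation set and the bound is immediate.
  ... | no ¬ex = S , id , (λ {c} c∈ → contradiction (c , c∈) ¬ex) , ℕ.m≤m+n _ _

theorem1 : (n : ℕ) (G : Graph n) →
    Σ (VSet n) λ D → IsDissociationSet G D ×
    (3 * n ≤ 3 * ∣ D ∣ + (edges G + components G + c₁ G))
theorem1 n G with InGraph.components-cover G
... | L , cov , eq with InGraph.good G (suc ∣ InGraph.full G ∣) (InGraph.full G) ≤-refl cov
... | D , _ , diss , bound = D , Diss⇒IsDissociationSet {D} diss , (begin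
    3 * n                                   ≤⟨ ℕ.*-monoʳ-≤ 3 n≤ ⟩
    3 * ∣ full ∣                            ≤⟨ bound ⟩
    3 * ∣ D ∣ + (E full + length L + c₁In full)
      ≤⟨ ℕ.+-monoʳ-≤ (3 * ∣ D ∣) (ℕ.+-mono-≤ (ℕ.+-mono-≤ (E≤edges full) (ℕ.≤-reflexive eq)) (c₁In≤c₁ full)) ⟩
    3 * ∣ D ∣ + (edges G + components G + c₁ G) ∎)
  where
  open InGraph G
  open ≤-Reasoning
  n≤ : n ≤ ∣ full ∣
  n≤ = subst (_≤ ∣ full ∣) (length-tabulate id) (length≤∣∣ full (Unique.allFin⁺ n) (λ _ → tt))
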